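{- There exists an absolute constant $C>0$ such that for every integer $n\ge 5$ and every simple graph $G$ of order $n$ (not necessarily connected) with exactly $d\ge 2$ distinct eigenvalues, there exists a switching $s\in\{\pm1\}^n$ such that $$M_*(s)\ \ge\ d - C\,\frac{d}{(\log d)^{1/4}}.$$
   Context: Let $G$ be a finite simple undirected graph on vertex set $\{1,\dots,n\}$ with (0/1) adjacency matrix $A(G)$; the eigenvalues of $G$ are those of $A(G)$. A switching is a vector $s=(s_1,\dots,s_n)\in\{\pm1\}^n$. The signed graph $G^{s}$ has underlying graph $G$ and sign $s_is_j$ on each edge $ij$; its adjacency matrix is $A(G^{s})=D_sA(G)D_s$, where $D_s$ is the diagonal matrix with diagonal $s$. An eigenvalue $\lambda$ of $A(G^s)$ is called main if it has an eigenvector not orthogonal to the all-ones vector. Let $\operatorname{spec}(G)$ be the set of distinct eigenvalues of $A(G)$, so $d=|\operatorname{spec}(G)|$; for $\lambda\in\operatorname{spec}(G)$ let $E_\lambda\subseteq\mathbb{R}^n$ be the $\lambda$-eigenspace of $A(G)$. Let $s^\perp=\{x\in\mathbb{R}^n: s^\top x=0\}$. Define $$M_*(s):=\bigl|\{\lambda\in\operatorname{spec}(G): E_\lambda\not\subseteq s^\perp\}\bigr| .$$ Thus $M_*(s)$ is the number of distinct main eigenvalues of $G^{s}$. -}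

module Defs where

open import Data.Bool.Base using (Bool; false; if_then_else_)
open import Data.Fin.Base using (Fin)
open import Data.Integer.Base as ℤ using (ℤ; +_; -[1+_])
import Data.Integer.Properties as ℤ
open import Data.Nat.Base as ℕ using (ℕ; zero; suc; z≤n; s≤s)
import Data.Nat.Properties as ℕ
open import Data.Product.Base using (∃; _×_; _,_; proj₁; proj₂)
open import Data.Rational.Base
  using (ℚ; 0ℚ; 1ℚ; ½; _/_; _+_; _*_; _-_; -_; 1/_; ∣_∣; _≤_; _<_; ↥_; ↧_;
         *≤*; *<*; toℚᵘ; Positive; NonNegative; positive; nonNegative; ≢-nonZero)
open import Data.Rational.Properties as ℚ
  using (module ≤-Reasoning)
open import Data.Rational.Solver using (module +-*-Solver)
open import Data.Rational.Unnormalised.Base as ℚᵘ using (mkℚᵘ)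
import Data.Rational.Unnormalised.Properties as ℚᵘ
open import Data.Sign.Base as Sign using (Sign)
open import Data.Sum.Base using (_⊎_; inj₁; inj₂)
open import Data.Vec.Functional using (Vector; foldr)
open import Function.Base using (_on_; _∘_)
open import Function.Definitions using (Bijective)
open import Level using (0ℓ)
open import Relation.Binary.Core using (Rel)
open import Relation.Binary.PropositionalEquality
  using (_≡_; refl; sym; trans; cong; cong₂; subst; subst₂)
open import Relation.Nullary using (¬_; Dec; yes; no; contradiction)
open import Relation.Unary using (Pred; _⊈_)

module ℚ-Lemmas where

  open +-*-Solver

  ι : ℕ → ℚ
  ι n = + n / 1

  1/suc : ℕ → ℚ
  1/suc k = + 1 / suc k

  pos : ∀ {p} → 0ℚ < p → Positive p
  pos = positive

  nneg : ∀ {p} → 0ℚ ≤ p → NonNegative p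
  nneg = nonNegative

  <⊎≥ : ∀ p q → p < q ⊎ q ≤ p
  <⊎≥ p q with p ℚ.<? q
  ... | yes p<q = inj₁ p<q
  ... | no  p≮q = inj₂ (ℚ.≮⇒≥ p≮q)

  *-mono-≤ : ∀ {p q r s} → 0ℚ ≤ p → 0ℚ ≤ s → p ≤ q → r ≤ s → p * r ≤ q * s
  *-mono-≤ {p} {q} {r} {s} 0≤p 0≤s p≤q r≤s = ℚ.≤-trans
    (ℚ.*-monoˡ-≤-nonNeg p {{nneg 0≤p}} r≤s)
    (ℚ.*-monoʳ-≤-nonNeg s {{nneg 0≤s}} p≤q)

  0≤p*q : ∀ {p q} → 0ℚ ≤ p → 0ℚ ≤ q → 0ℚ ≤ p * q
  0≤p*q {p} {q} 0≤p 0≤q = ℚ.nonNegative⁻¹ (p * q)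
    {{ℚ.nonNeg*nonNeg⇒nonNeg p {{nneg 0≤p}} q {{nneg 0≤q}}}}

  0<p*q : ∀ {p q} → 0ℚ < p → 0ℚ < q → 0ℚ < p * q
  0<p*q {p} {q} 0<p 0<q = ℚ.positive⁻¹ (p * q)
    {{ℚ.pos*pos⇒pos p {{pos 0<p}} q {{pos 0<q}}}}

  0<p+q : ∀ {p q} → 0ℚ < p → 0ℚ < q → 0ℚ < p + q
  0<p+q {p} {q} 0<p 0<q = subst (_< p + q) (ℚ.+-identityˡ 0ℚ) (ℚ.+-mono-< 0<p 0<q)

  p≤p+q : ∀ p {q} → 0ℚ ≤ q → p ≤ p + q
  p≤p+q p {q} 0≤q = subst (_≤ p + q) (ℚ.+-identityʳ p) (ℚ.+-monoʳ-≤ p 0≤q)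

  p<p+q : ∀ p {q} → 0ℚ < q → p < p + q
  p<p+q p {q} 0<q = subst (_< p + q) (ℚ.+-identityʳ p) (ℚ.+-monoʳ-< p 0<q)

  0<½ : 0ℚ < ½
  0<½ = ℚ.positive⁻¹ ½

  0<1 : 0ℚ < 1ℚ
  0<1 = ℚ.positive⁻¹ 1ℚ

  halves : ∀ p → p * ½ + p * ½ ≡ p
  halves = solve 1 (λ p → p :* con ½ :+ p :* con ½ := p) refl

  0<half : ∀ {p} → 0ℚ < p → 0ℚ < p * ½
  0<half 0<p = 0<p*q 0<p 0<½

  p≤∣p∣ : ∀ p → p ≤ ∣ p ∣
  p≤∣p∣ p with ℚ.≤-total 0ℚ p
  ... | inj₁ 0≤p = ℚ.≤-reflexive (sym (ℚ.0≤p⇒∣p∣≡p 0≤p))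
  ... | inj₂ p≤0 = ℚ.≤-trans p≤0 (ℚ.0≤∣p∣ p)

  ∣p-q∣<ε⇒p<q+ε : ∀ p q {ε} → ∣ p - q ∣ < ε → p < q + ε
  ∣p-q∣<ε⇒p<q+ε p q {ε} h = subst (_< q + ε)
    (solve 2 (λ p q → q :+ (p :- q) := p) refl p q)
    (ℚ.+-monoʳ-< q (ℚ.≤-<-trans (p≤∣p∣ (p - q)) h))

  p<q+ε⇒p-q<ε : ∀ p q {ε} → p < q + ε → p - q < ε
  p<q+ε⇒p-q<ε p q {ε} h = subst (p - q <_)
    (solve 2 (λ q e → (q :+ e) :- q := e) refl q ε)
    (ℚ.+-monoˡ-< (- q) h)

  both⇒∣p-q∣<ε : ∀ p q {ε} → p < q + ε → q < p + ε → ∣ p - q ∣ < ε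
  both⇒∣p-q∣<ε p q h k with ℚ.∣p∣≡p∨∣p∣≡-p (p - q)
  ... | inj₁ eq = subst (_< _) (sym eq) (p<q+ε⇒p-q<ε p q h)
  ... | inj₂ eq = subst (_< _)
    (sym (trans eq (solve 2 (λ p q → :- (p :- q) := q :- p) refl p q)))
    (p<q+ε⇒p-q<ε q p k)

  toℚᵘ-/ : ∀ k n → toℚᵘ (+ k / suc n) ℚᵘ.≃ mkℚᵘ (+ k) n
  toℚᵘ-/ k n = ℚ.toℚᵘ-fromℚᵘ (mkℚᵘ (+ k) n)

  ι-mono-≤ : ∀ {m n} → m ℕ.≤ n → ι m ≤ ι n
  ι-mono-≤ {m} {n} m≤n = ℚ.toℚᵘ-cancel-≤ (ℚᵘ.≤-respˡ-≃ (ℚᵘ.≃-sym (toℚᵘ-/ m 0))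
    (ℚᵘ.≤-respʳ-≃ (ℚᵘ.≃-sym (toℚᵘ-/ n 0))
      (ℚᵘ.*≤* (ℤ.*-monoʳ-≤-nonNeg (+ 1) (ℤ.+≤+ m≤n)))))

  ι-+ : ∀ m n → ι (m ℕ.+ n) ≡ ι m + ι n
  ι-+ m n = ℚ.toℚᵘ-injective (ℚᵘ.≃-trans (toℚᵘ-/ (m ℕ.+ n) 0) (ℚᵘ.≃-sym
    (ℚᵘ.≃-trans (ℚ.toℚᵘ-homo-+ (ι m) (ι n))
    (ℚᵘ.≃-trans (ℚᵘ.+-cong (toℚᵘ-/ m 0) (toℚᵘ-/ n 0))
      (ℚᵘ.*≡* (cong (ℤ._* + 1)
        (cong₂ ℤ._+_ (ℤ.*-identityʳ (+ m)) (ℤ.*-identityʳ (+ n)))))))))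

  ι-* : ∀ m n → ι (m ℕ.* n) ≡ ι m * ι n
  ι-* m n = ℚ.toℚᵘ-injective (ℚᵘ.≃-trans (toℚᵘ-/ (m ℕ.* n) 0) (ℚᵘ.≃-sym
    (ℚᵘ.≃-trans (ℚ.toℚᵘ-homo-* (ι m) (ι n))
    (ℚᵘ.≃-trans (ℚᵘ.*-cong (toℚᵘ-/ m 0) (toℚᵘ-/ n 0))
      (ℚᵘ.*≡* (cong (ℤ._* + 1) (sym (ℤ.pos-* m n))))))))

  0≤ι : ∀ n → 0ℚ ≤ ι n
  0≤ι n = ι-mono-≤ {0} {n} z≤n

  k/n≡ : ∀ k n → + k / suc n ≡ ι k * 1/suc n
  k/n≡ k n = ℚ.toℚᵘ-injective (ℚᵘ.≃-trans (toℚᵘ-/ k n) (ℚᵘ.≃-sym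
    (ℚᵘ.≃-trans (ℚ.toℚᵘ-homo-* (ι k) (1/suc n))
    (ℚᵘ.≃-trans (ℚᵘ.*-cong (toℚᵘ-/ k 0) (toℚᵘ-/ 1 n))
      (ℚᵘ.*≡* (cong₂ ℤ._*_ (ℤ.*-identityʳ (+ k))
        (cong (λ j → + suc j) (sym (ℕ.+-identityʳ n)))))))))

  ι-suc*1/suc : ∀ n → ι (suc n) * 1/suc n ≡ 1ℚ
  ι-suc*1/suc n = trans (sym (k/n≡ (suc n) n))
    (ℚ.toℚᵘ-injective (ℚᵘ.≃-trans (toℚᵘ-/ (suc n) n)
      (ℚᵘ.*≡* (ℤ.*-comm (+ suc n) (+ 1)))))

  0<1/suc : ∀ n → 0ℚ < 1/suc n
  0<1/suc n = ℚ.toℚᵘ-cancel-< (ℚᵘ.<-respʳ-≃ (ℚᵘ.≃-sym (toℚᵘ-/ 1 n))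
    (ℚᵘ.*<* (ℤ.+<+ (s≤s z≤n))))

  1/suc-anti : ∀ {j k} → j ℕ.≤ k → 1/suc k ≤ 1/suc j
  1/suc-anti {j} {k} j≤k = begin
    1/suc k                           ≡⟨ ℚ.*-identityʳ _ ⟨
    1/suc k * 1ℚ                      ≡⟨ cong (1/suc k *_) (ι-suc*1/suc j) ⟨
    1/suc k * (ι (suc j) * 1/suc j)   ≤⟨ ℚ.*-monoˡ-≤-nonNeg (1/suc k) {{nneg (ℚ.<⇒≤ (0<1/suc k))}}
                                          (ℚ.*-monoʳ-≤-nonNeg (1/suc j) {{nneg (ℚ.<⇒≤ (0<1/suc j))}}
                                            (ι-mono-≤ (s≤s j≤k))) ⟩
    1/suc k * (ι (suc k) * 1/suc j)   ≡⟨ solve 3 (λ a b c → a :* (b :* c) := (b :* a) :* c) refl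
                                          (1/suc k) (ι (suc k)) (1/suc j) ⟩
    (ι (suc k) * 1/suc k) * 1/suc j   ≡⟨ cong (_* 1/suc j) (ι-suc*1/suc k) ⟩
    1ℚ * 1/suc j                      ≡⟨ ℚ.*-identityˡ _ ⟩
    1/suc j                           ∎
    where open ≤-Reasoning

  q<ι : ∀ q → q < ι (suc ℤ.∣ ↥ q ∣)
  q<ι q@record{} = ℚ.toℚᵘ-cancel-< (ℚᵘ.<-respʳ-≃ (ℚᵘ.≃-sym (toℚᵘ-/ (suc ℤ.∣ ↥ q ∣) 0))
    (ℚᵘ.*<* (ℤ.<-≤-trans step₁ step₂)))
    where
    c = ℤ.∣ ↥ q ∣

    i≤∣i∣ : ∀ i → i ℤ.≤ + ℤ.∣ i ∣
    i≤∣i∣ (+ n)    = ℤ.≤-refl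
    i≤∣i∣ -[1+ n ] = ℤ.-≤+

    step₁ : ↥ q ℤ.* + 1 ℤ.< + suc c
    step₁ = subst (ℤ._< + suc c) (sym (ℤ.*-identityʳ (↥ q)))
      (ℤ.≤-<-trans (i≤∣i∣ (↥ q)) (ℤ.+<+ ℕ.≤-refl))

    step₂ : + suc c ℤ.≤ + suc c ℤ.* ↧ q
    step₂ = subst (ℤ._≤ + suc c ℤ.* ↧ q) (ℤ.*-identityʳ (+ suc c))
      (ℤ.*-monoˡ-≤-nonNeg (+ suc c) (ℤ.+≤+ (s≤s z≤n)))

  recip : ℚ → ℚ
  recip q with q ℚ.≟ 0ℚ
  ... | yes _   = 0ℚ
  ... | no  q≢0 = (1/ q) {{≢-nonZero q≢0}}

  recip-inverse : ∀ {q} → 0ℚ < q → recip q * q ≡ 1ℚ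
  recip-inverse {q} 0<q with q ℚ.≟ 0ℚ
  ... | yes q≡0 = contradiction (sym q≡0) (ℚ.<⇒≢ 0<q)
  ... | no  q≢0 = ℚ.*-inverseˡ q {{≢-nonZero q≢0}}

  0<recip : ∀ {q} → 0ℚ < q → 0ℚ < recip q
  0<recip {q} 0<q with <⊎≥ 0ℚ (recip q)
  ... | inj₁ h = h
  ... | inj₂ h = contradiction
    (ℚ.<-≤-trans 0<1 (subst₂ _≤_ (recip-inverse 0<q) (ℚ.*-zeroˡ q)
      (ℚ.*-monoʳ-≤-nonNeg q {{nneg (ℚ.<⇒≤ 0<q)}} h)))
    (ℚ.<-irrefl refl)

  recip-anti : ∀ {p q} → 0ℚ < p → p ≤ q → recip q ≤ recip p
  recip-anti {p} {q} 0<p p≤q = begin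
    recip q                   ≡⟨ ℚ.*-identityʳ _ ⟨
    recip q * 1ℚ              ≡⟨ cong (recip q *_) (recip-inverse 0<p) ⟨
    recip q * (recip p * p)   ≤⟨ ℚ.*-monoˡ-≤-nonNeg (recip q) {{nneg (ℚ.<⇒≤ (0<recip 0<q))}}
                                  (ℚ.*-monoˡ-≤-nonNeg (recip p) {{nneg (ℚ.<⇒≤ (0<recip 0<p))}} p≤q) ⟩
    recip q * (recip p * q)   ≡⟨ solve 3 (λ a b c → a :* (b :* c) := (a :* c) :* b) refl
                                  (recip q) (recip p) q ⟩
    (recip q * q) * recip p   ≡⟨ cong (_* recip p) (recip-inverse 0<q) ⟩
    1ℚ * recip p              ≡⟨ ℚ.*-identityˡ _ ⟩
    recip p                   ∎
    where
    open ≤-Reasoning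
    0<q = ℚ.<-≤-trans 0<p p≤q

  archimedean : ∀ {ε} → 0ℚ < ε → ∃ λ N → ∀ n → N ℕ.≤ n → 1/suc n < ε
  archimedean {ε} 0<ε = N , λ n N≤n → ℚ.≤-<-trans (1/suc-anti N≤n) small
    where
    N = suc ℤ.∣ ↥ (recip ε) ∣
    big : recip ε < ι (suc N)
    big = ℚ.<-≤-trans (q<ι (recip ε)) (ι-mono-≤ (ℕ.n≤1+n N))
    open ≤-Reasoning
    small : 1/suc N < ε
    small = begin-strict
      1/suc N                     ≡⟨ ℚ.*-identityˡ _ ⟨
      1ℚ * 1/suc N                ≡⟨ cong (_* 1/suc N) (recip-inverse 0<ε) ⟨
      (recip ε * ε) * 1/suc N     ≡⟨ solve 3 (λ a b c → (a :* b) :* c := a :* (b :* c)) refl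
                                      (recip ε) ε (1/suc N) ⟩
      recip ε * (ε * 1/suc N)     <⟨ ℚ.*-monoˡ-<-pos (ε * 1/suc N) {{pos (0<p*q 0<ε (0<1/suc N))}} big ⟩
      ι (suc N) * (ε * 1/suc N)   ≡⟨ solve 3 (λ a b c → a :* (b :* c) := b :* (a :* c)) refl
                                      (ι (suc N)) ε (1/suc N) ⟩
      ε * (ι (suc N) * 1/suc N)   ≡⟨ cong (ε *_) (ι-suc*1/suc N) ⟩
      ε * 1ℚ                      ≡⟨ ℚ.*-identityʳ ε ⟩
      ε                           ∎

  pow4 : ℚ → ℚ
  pow4 q = (q * q) * (q * q)

  sq-mono : ∀ {p q} → 0ℚ ≤ p → p ≤ q → p * p ≤ q * q
  sq-mono 0≤p p≤q = *-mono-≤ 0≤p (ℚ.≤-trans 0≤p p≤q) p≤q p≤q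

  pow4-mono : ∀ {p q} → 0ℚ ≤ p → p ≤ q → pow4 p ≤ pow4 q
  pow4-mono 0≤p p≤q = sq-mono (0≤p*q 0≤p 0≤p) (sq-mono 0≤p p≤q)

  sq-super : ∀ {p q} → 0ℚ ≤ p → 0ℚ ≤ q → p * p + q * q ≤ (p + q) * (p + q)
  sq-super {p} {q} 0≤p 0≤q = subst (p * p + q * q ≤_)
    (solve 2 (λ p q → p :* p :+ q :* q :+ (p :* q :+ p :* q) := (p :+ q) :* (p :+ q)) refl p q)
    (p≤p+q _ (ℚ.≤-trans (0≤p*q 0≤p 0≤q) (p≤p+q _ (0≤p*q 0≤p 0≤q))))

  pow4-super : ∀ {p q} → 0ℚ ≤ p → 0ℚ ≤ q → pow4 p + pow4 q ≤ pow4 (p + q)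
  pow4-super {p} {q} 0≤p 0≤q = ℚ.≤-trans
    (sq-super (0≤p*q 0≤p 0≤p) (0≤p*q 0≤q 0≤q))
    (sq-mono (ℚ.≤-trans (0≤p*q 0≤p 0≤p) (p≤p+q _ (0≤p*q 0≤q 0≤q))) (sq-super 0≤p 0≤q))

  0<pow4 : ∀ {p} → 0ℚ < p → 0ℚ < pow4 p
  0<pow4 0<p = 0<p*q (0<p*q 0<p 0<p) (0<p*q 0<p 0<p)

  pow4≤ : ∀ {p} → 0ℚ ≤ p → p ≤ 1ℚ → pow4 p ≤ p
  pow4≤ {p} 0≤p p≤1 = begin
    (p * p) * (p * p)     ≤⟨ *-mono-≤ (0≤p*q 0≤p 0≤p) (ℚ.<⇒≤ 0<1) p*p≤p (ℚ.≤-trans p*p≤p p≤1) ⟩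
    p * 1ℚ                ≡⟨ ℚ.*-identityʳ p ⟩
    p                     ∎
    where
    open ≤-Reasoning
    p*p≤p : p * p ≤ p
    p*p≤p = subst (p * p ≤_) (ℚ.*-identityʳ p) (ℚ.*-monoˡ-≤-nonNeg p {{nneg 0≤p}} p≤1)

  ≤pow4 : ∀ {p} → 1ℚ ≤ p → p ≤ pow4 p
  ≤pow4 {p} 1≤p = ℚ.≤-trans p≤p*p (ℚ.≤-trans
    (ℚ.≤-reflexive (sym (ℚ.*-identityʳ (p * p))))
    (ℚ.*-monoˡ-≤-nonNeg (p * p) {{nneg (0≤p*q 0≤p 0≤p)}} (ℚ.≤-trans 1≤p p≤p*p)))
    where
    0≤p = ℚ.≤-trans (ℚ.<⇒≤ 0<1) 1≤p
    p≤p*p : p ≤ p * p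
    p≤p*p = subst (_≤ p * p) (ℚ.*-identityʳ p) (ℚ.*-monoˡ-≤-nonNeg p {{nneg 0≤p}} 1≤p)

  rsum : (ℕ → ℚ) → ℕ → ℚ
  rsum f zero    = 0ℚ
  rsum f (suc k) = rsum f k + f k

  rsum-split : ∀ f k l → rsum f (k ℕ.+ l) ≡ rsum f k + rsum (λ j → f (k ℕ.+ j)) l
  rsum-split f k zero    = trans (cong (rsum f) (ℕ.+-identityʳ k)) (sym (ℚ.+-identityʳ (rsum f k)))
  rsum-split f k (suc l) = trans (cong (rsum f) (ℕ.+-suc k l))
    (trans (cong (_+ f (k ℕ.+ l)) (rsum-split f k l))
      (ℚ.+-assoc (rsum f k) (rsum (λ j → f (k ℕ.+ j)) l) (f (k ℕ.+ l))))

  rsum-lower : ∀ g k b → (∀ j → j ℕ.< k → b ≤ g j) → ι k * b ≤ rsum g k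
  rsum-lower g zero    b h = ℚ.≤-reflexive (ℚ.*-zeroˡ b)
  rsum-lower g (suc k) b h = subst (_≤ rsum g (suc k)) (sym eq)
    (ℚ.+-mono-≤ (rsum-lower g k b (λ j j<k → h j (ℕ.m≤n⇒m≤1+n j<k))) (h k ℕ.≤-refl))
    where
    eq : ι (suc k) * b ≡ ι k * b + b
    eq = trans (cong (λ x → x * b) (trans (cong ι (ℕ.+-comm 1 k)) (ι-+ k 1)))
      (solve 2 (λ x b → (x :+ con 1ℚ) :* b := x :* b :+ b) refl (ι k) b)

  rsum-upper : ∀ g k b → (∀ j → j ℕ.< k → g j ≤ b) → rsum g k ≤ ι k * b
  rsum-upper g zero    b h = ℚ.≤-reflexive (sym (ℚ.*-zeroˡ b))
  rsum-upper g (suc k) b h = subst (rsum g (suc k) ≤_) (sym eq)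
    (ℚ.+-mono-≤ (rsum-upper g k b (λ j j<k → h j (ℕ.m≤n⇒m≤1+n j<k))) (h k ℕ.≤-refl))
    where
    eq : ι (suc k) * b ≡ ι k * b + b
    eq = trans (cong (λ x → x * b) (trans (cong ι (ℕ.+-comm 1 k)) (ι-+ k 1)))
      (solve 2 (λ x b → (x :+ con 1ℚ) :* b := x :* b :+ b) refl (ι k) b)

open ℚ-Lemmas

IsCauchy : (ℕ → ℚ) → Set
IsCauchy x = ∀ ε → 0ℚ < ε → ∃ λ N → ∀ m n → N ℕ.≤ m → N ℕ.≤ n → ∣ x m - x n ∣ < ε

-- Two Cauchy sequences are the same real number when related by _≈ℝ_, not _≡_.
record ℝ : Set where
  no-eta-equality
  field
    seq      : ℕ → ℚ
    isCauchy : IsCauchy seq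

open ℝ public

infix 4 _≈ℝ_ _≤ℝ_ _<ℝ_

record _≈ℝ_ (x y : ℝ) : Set where
  constructor mk≈
  field
    close : ∀ ε → 0ℚ < ε → ∃ λ N → ∀ n → N ℕ.≤ n → ∣ seq x n - seq y n ∣ < ε

record _≤ℝ_ (x y : ℝ) : Set where
  constructor mk≤
  field
    below : ∀ ε → 0ℚ < ε → ∃ λ N → ∀ n → N ℕ.≤ n → seq x n ≤ seq y n + ε

record _<ℝ_ (x y : ℝ) : Set where
  constructor mk<
  field
    gap   : ℚ
    0<gap : 0ℚ < gap
    from  : ℕ
    apart : ∀ n → from ℕ.≤ n → seq x n + gap ≤ seq y n

module Cauchy-Lemmas where

  open +-*-Solver

  one-sided : ∀ x →
    (∀ ε → 0ℚ < ε → ∃ λ N → ∀ m n → N ℕ.≤ m → N ℕ.≤ n → x m < x n + ε) → IsCauchy x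
  one-sided x h ε 0<ε with h ε 0<ε
  ... | N , k = N , λ m n N≤m N≤n → both⇒∣p-q∣<ε (x m) (x n) (k m n N≤m N≤n) (k n m N≤n N≤m)

  bounded : ∀ {x} → IsCauchy x → ∃ λ K → 0ℚ < K × ∃ λ N → ∀ n → N ℕ.≤ n → ∣ x n ∣ ≤ K
  bounded {x} c with c 1ℚ 0<1
  ... | N , h = ∣ x N ∣ + 1ℚ ,
    ℚ.≤-<-trans (ℚ.0≤∣p∣ (x N)) (p<p+q _ 0<1) ,
    N , λ n N≤n → begin
      ∣ x n ∣                    ≡⟨ cong ∣_∣ (solve 2 (λ a b → a := b :+ (a :- b)) refl (x n) (x N)) ⟩
      ∣ x N + (x n - x N) ∣      ≤⟨ ℚ.∣p+q∣≤∣p∣+∣q∣ (x N) (x n - x N) ⟩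
      ∣ x N ∣ + ∣ x n - x N ∣    ≤⟨ ℚ.+-monoʳ-≤ ∣ x N ∣ (ℚ.<⇒≤ (h n N N≤n ℕ.≤-refl)) ⟩
      ∣ x N ∣ + 1ℚ               ∎
    where open ≤-Reasoning

  const-cauchy : ∀ q → IsCauchy (λ _ → q)
  const-cauchy q = one-sided _ λ ε 0<ε → 0 , λ _ _ _ _ → p<p+q q 0<ε

  +-cauchy : ∀ {x y} → IsCauchy x → IsCauchy y → IsCauchy (λ n → x n + y n)
  +-cauchy {x} {y} cx cy = one-sided _ λ ε 0<ε →
    let M , h = cx (ε * ½) (0<half 0<ε)
        N , k = cy (ε * ½) (0<half 0<ε)
    in M ℕ.⊔ N , λ m n m≥ n≥ → begin-strict
      x m + y m                         <⟨ ℚ.+-mono-<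
        (∣p-q∣<ε⇒p<q+ε (x m) (x n) (h m n (ℕ.m⊔n≤o⇒m≤o M N m≥) (ℕ.m⊔n≤o⇒m≤o M N n≥)))
        (∣p-q∣<ε⇒p<q+ε (y m) (y n) (k m n (ℕ.m⊔n≤o⇒n≤o M N m≥) (ℕ.m⊔n≤o⇒n≤o M N n≥))) ⟩
      (x n + ε * ½) + (y n + ε * ½)     ≡⟨ solve 3 (λ a b e →
        (a :+ e :* con ½) :+ (b :+ e :* con ½) := (a :+ b) :+ e) refl (x n) (y n) ε ⟩
      (x n + y n) + ε                   ∎
    where open ≤-Reasoning

  neg-cauchy : ∀ {x} → IsCauchy x → IsCauchy (λ n → - x n)
  neg-cauchy {x} cx ε 0<ε with cx ε 0<ε
  ... | N , h = N , λ m n N≤m N≤n → subst (_< ε)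
    (trans (sym (ℚ.∣-p∣≡∣p∣ (x m - x n)))
      (cong ∣_∣ (solve 2 (λ a b → :- (a :- b) := (:- a) :- (:- b)) refl (x m) (x n))))
    (h m n N≤m N≤n)

  product-bound : ∀ a b c d B δ → 0ℚ < B → ∣ a ∣ ≤ B → ∣ d ∣ ≤ B →
                  ∣ b - d ∣ < δ → ∣ a - c ∣ < δ → ∣ a * b - c * d ∣ < B * (δ + δ)
  product-bound a b c d B δ 0<B a≤B d≤B b-d< a-c< = begin-strict
    ∣ a * b - c * d ∣
      ≡⟨ cong ∣_∣ (solve 4 (λ a b c d → a :* b :- c :* d := a :* (b :- d) :+ d :* (a :- c))
           refl a b c d) ⟩
    ∣ a * (b - d) + d * (a - c) ∣
      ≤⟨ ℚ.∣p+q∣≤∣p∣+∣q∣ (a * (b - d)) (d * (a - c)) ⟩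
    ∣ a * (b - d) ∣ + ∣ d * (a - c) ∣
      ≡⟨ cong₂ _+_ (ℚ.∣p*q∣≡∣p∣*∣q∣ a (b - d)) (ℚ.∣p*q∣≡∣p∣*∣q∣ d (a - c)) ⟩
    ∣ a ∣ * ∣ b - d ∣ + ∣ d ∣ * ∣ a - c ∣
      ≤⟨ ℚ.+-mono-≤
           (ℚ.*-monoʳ-≤-nonNeg ∣ b - d ∣ {{nneg (ℚ.0≤∣p∣ (b - d))}} a≤B)
           (ℚ.*-monoʳ-≤-nonNeg ∣ a - c ∣ {{nneg (ℚ.0≤∣p∣ (a - c))}} d≤B) ⟩
    B * ∣ b - d ∣ + B * ∣ a - c ∣
      <⟨ ℚ.+-mono-<
           (ℚ.*-monoʳ-<-pos B {{pos 0<B}} b-d<)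
           (ℚ.*-monoʳ-<-pos B {{pos 0<B}} a-c<) ⟩
    B * δ + B * δ
      ≡⟨ ℚ.*-distribˡ-+ B δ δ ⟨
    B * (δ + δ) ∎
    where open ≤-Reasoning

  *-cauchy-bounded : ∀ {x y} → IsCauchy x → IsCauchy y → ∀ B M → 0ℚ < B →
    (∀ n → M ℕ.≤ n → ∣ x n ∣ ≤ B) → (∀ n → M ℕ.≤ n → ∣ y n ∣ ≤ B) →
    IsCauchy (λ n → x n * y n)
  *-cauchy-bounded {x} {y} cx cy B M 0<B bx by ε 0<ε =
    M ℕ.⊔ (N₁ ℕ.⊔ N₂) , λ m n m≥ n≥ → subst (∣ x m * y m - x n * y n ∣ <_) Bδ
      (product-bound (x m) (y m) (x n) (y n) B δ 0<B
        (bx m (ℕ.m⊔n≤o⇒m≤o M _ m≥)) (by n (ℕ.m⊔n≤o⇒m≤o M _ n≥))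
        (hy m n (≥N₂ m≥) (≥N₂ n≥)) (hx m n (≥N₁ m≥) (≥N₁ n≥)))
    where
    δ : ℚ
    δ = recip B * (ε * ½)
    0<δ : 0ℚ < δ
    0<δ = 0<p*q (0<recip 0<B) (0<half 0<ε)
    N₁ N₂ : ℕ
    N₁ = proj₁ (cx δ 0<δ)
    N₂ = proj₁ (cy δ 0<δ)
    hx = proj₂ (cx δ 0<δ)
    hy = proj₂ (cy δ 0<δ)
    ≥N₁ : ∀ {k} → M ℕ.⊔ (N₁ ℕ.⊔ N₂) ℕ.≤ k → N₁ ℕ.≤ k
    ≥N₁ k≥ = ℕ.m⊔n≤o⇒m≤o N₁ N₂ (ℕ.m⊔n≤o⇒n≤o M (N₁ ℕ.⊔ N₂) k≥)
    ≥N₂ : ∀ {k} → M ℕ.⊔ (N₁ ℕ.⊔ N₂) ℕ.≤ k → N₂ ℕ.≤ k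
    ≥N₂ k≥ = ℕ.m⊔n≤o⇒n≤o N₁ N₂ (ℕ.m⊔n≤o⇒n≤o M (N₁ ℕ.⊔ N₂) k≥)
    Bδ : B * (δ + δ) ≡ ε
    Bδ = trans (solve 3 (λ b r h → b :* (r :* h :+ r :* h) := (r :* b) :* (h :+ h))
                 refl B (recip B) (ε * ½))
         (trans (cong₂ _*_ (recip-inverse 0<B) (halves ε)) (ℚ.*-identityˡ ε))

  *-cauchy : ∀ {x y} → IsCauchy x → IsCauchy y → IsCauchy (λ n → x n * y n)
  *-cauchy {x} {y} cx cy =
    let K , 0<K , M , bx = bounded {x} cx
        L , 0<L , N , by = bounded {y} cy
    in *-cauchy-bounded {x} {y} cx cy (K + L) (M ℕ.⊔ N) (0<p+q 0<K 0<L)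
      (λ n n≥ → ℚ.≤-trans (bx n (ℕ.m⊔n≤o⇒m≤o M N n≥)) (p≤p+q K (ℚ.<⇒≤ 0<L)))
      (λ n n≥ → ℚ.≤-trans (by n (ℕ.m⊔n≤o⇒n≤o M N n≥))
        (subst (L ≤_) (ℚ.+-comm L K) (p≤p+q L (ℚ.<⇒≤ 0<K))))

  recip-cauchy : ∀ {x δ N} → IsCauchy x → 0ℚ < δ → (∀ n → N ℕ.≤ n → δ ≤ x n) →
                 IsCauchy (λ n → recip (x n))
  recip-cauchy {x} {δ} {N} cx 0<δ δ≤x = one-sided _ λ ε 0<ε →
    let η     = ε * (δ * δ)
        0<η   = 0<p*q 0<ε (0<p*q 0<δ 0<δ)
        M , h = cx η 0<η
    in N ℕ.⊔ M , λ m n m≥ n≥ →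
      let 0<xm = ℚ.<-≤-trans 0<δ (δ≤x m (ℕ.m⊔n≤o⇒m≤o N M m≥))
          0<xn = ℚ.<-≤-trans 0<δ (δ≤x n (ℕ.m⊔n≤o⇒m≤o N M n≥))
          rm = recip (x m)
          rn = recip (x n)
          0<rm = 0<recip 0<xm
          0<rn = 0<recip 0<xn
          rd = recip δ
          0<rd = 0<recip 0<δ
      in begin-strict
        rm                                ≡⟨ ℚ.*-identityʳ rm ⟨
        rm * 1ℚ                           ≡⟨ cong (rm *_) (recip-inverse 0<xn) ⟨
        rm * (rn * x n)                   <⟨ ℚ.*-monoʳ-<-pos rm {{pos 0<rm}} (ℚ.*-monoʳ-<-pos rn {{pos 0<rn}}
                                               (∣p-q∣<ε⇒p<q+ε (x n) (x m)
                                                 (h n m (ℕ.m⊔n≤o⇒n≤o N M n≥) (ℕ.m⊔n≤o⇒n≤o N M m≥)))) ⟩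
        rm * (rn * (x m + η))             ≡⟨ solve 4 (λ a b c e → a :* (b :* (c :+ e))
                                                := (a :* c) :* b :+ (a :* b) :* e) refl rm rn (x m) η ⟩
        (rm * x m) * rn + (rm * rn) * η   ≡⟨ cong (_+ (rm * rn) * η)
                                               (trans (cong (_* rn) (recip-inverse 0<xm)) (ℚ.*-identityˡ rn)) ⟩
        rn + (rm * rn) * η                ≤⟨ ℚ.+-monoʳ-≤ rn (ℚ.*-monoʳ-≤-nonNeg η {{nneg (ℚ.<⇒≤ 0<η)}}
                                               (*-mono-≤ (ℚ.<⇒≤ 0<rm) (ℚ.<⇒≤ 0<rd)
                                                 (recip-anti 0<δ (δ≤x m (ℕ.m⊔n≤o⇒m≤o N M m≥)))
                                                 (recip-anti 0<δ (δ≤x n (ℕ.m⊔n≤o⇒m≤o N M n≥))))) ⟩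
        rn + (rd * rd) * η                ≡⟨ solve 4 (λ a r d e → a :+ (r :* r) :* (e :* (d :* d))
                                                := a :+ ((r :* d) :* (r :* d)) :* e) refl rn rd δ ε ⟩
        rn + ((rd * δ) * (rd * δ)) * ε    ≡⟨ cong (λ z → rn + (z * z) * ε) (recip-inverse 0<δ) ⟩
        rn + (1ℚ * 1ℚ) * ε                ≡⟨ cong (λ z → rn + z) (ℚ.*-identityˡ ε) ⟩
        rn + ε                            ∎
    where open ≤-Reasoning

open Cauchy-Lemmas

fromℚ : ℚ → ℝ
seq      (fromℚ q) _ = q
isCauchy (fromℚ q)   = const-cauchy q

fromℕ : ℕ → ℝ
fromℕ n = fromℚ (+ n / 1)

0ℝ 1ℝ : ℝ
0ℝ = fromℚ 0ℚ
1ℝ = fromℚ 1ℚ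

infixl 6 _+ℝ_ _-ℝ_
infixl 7 _*ℝ_ _÷ℝ_[_]
infix  8 -ℝ_

_+ℝ_ : ℝ → ℝ → ℝ
seq      (x +ℝ y) n = seq x n + seq y n
isCauchy (x +ℝ y)   = +-cauchy {seq x} {seq y} (isCauchy x) (isCauchy y)

_*ℝ_ : ℝ → ℝ → ℝ
seq      (x *ℝ y) n = seq x n * seq y n
isCauchy (x *ℝ y)   = *-cauchy {seq x} {seq y} (isCauchy x) (isCauchy y)

-ℝ_ : ℝ → ℝ
seq      (-ℝ x) n = - seq x n
isCauchy (-ℝ x)   = neg-cauchy {seq x} (isCauchy x)

_-ℝ_ : ℝ → ℝ → ℝ
x -ℝ y = x +ℝ (-ℝ y)

-- `recip` is the reciprocal on ℚ extended by recip 0ℚ = 0ℚ; only finitely many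
-- terms of a sequence with positive limit are affected by this extension.
1/ℝ_[_] : (y : ℝ) → 0ℝ <ℝ y → ℝ
seq      1/ℝ y [ _ ] n = recip (seq y n)
isCauchy 1/ℝ y [ mk< δ 0<δ N h ] = recip-cauchy {seq y} (isCauchy y) 0<δ
  (λ n N≤n → subst (_≤ seq y n) (ℚ.+-identityˡ δ) (h n N≤n))

_÷ℝ_[_] : ℝ → (y : ℝ) → 0ℝ <ℝ y → ℝ
x ÷ℝ y [ 0<y ] = x *ℝ 1/ℝ y [ 0<y ]

-- With N = suc m this is the right-endpoint Riemann sum of mesh 1/N of
-- ∫₁ᵈ dt/t,  Σ_{j=1}^{(d-1)N} (1/N)·1/(1+j/N) = Σ_{j=1}^{(d-1)N} 1/(N+j).
-- For d = 0 it takes the junk value 0.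
riemannSum : ℕ → ℕ → ℚ
riemannSum d m = rsum (λ j → + 1 / (suc m ℕ.+ suc j)) ((d ℕ.∸ 1) ℕ.* suc m)

module Log-Lemmas (d : ℕ) where

  open +-*-Solver

  private
    e = d ℕ.∸ 1
    T = riemannSum d

  module Step (m : ℕ) where

    K = e ℕ.* suc m

    f : ℕ → ℚ
    f j = + 1 / (suc m ℕ.+ suc j)

    g : ℕ → ℚ
    g j = f (K ℕ.+ j)

    f≡ : ∀ j → f j ≡ 1/suc (suc (m ℕ.+ j))
    f≡ j = cong 1/suc (ℕ.+-suc m j)

    shift : ∀ k → f 0 + rsum (λ j → + 1 / (suc (suc m) ℕ.+ suc j)) k ≡ rsum f (suc k)
    shift zero    = ℚ.+-comm (f 0) 0ℚ
    shift (suc k) = trans (sym (ℚ.+-assoc (f 0) _ _))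
      (cong₂ _+_ (shift k) (cong 1/suc (sym (ℕ.+-suc m (suc k)))))

    balance : f 0 + T (suc m) ≡ T m + rsum g (suc e)
    balance = trans (shift (e ℕ.* suc (suc m)))
      (trans (cong (rsum f) (trans (cong suc (trans (ℕ.*-suc e (suc m)) (ℕ.+-comm e K))) (sym (ℕ.+-suc K e))))
        (rsum-split f K (suc e)))

    ι-1/ : ∀ n → ι (suc e) * 1/suc (n ℕ.+ e ℕ.* suc n) ≡ 1/suc n
    ι-1/ n = begin-equality
      ι (suc e) * u                         ≡⟨ ℚ.*-identityʳ _ ⟨
      ι (suc e) * u * 1ℚ                    ≡⟨ cong (ι (suc e) * u *_) (ι-suc*1/suc n) ⟨
      ι (suc e) * u * (ι (suc n) * 1/suc n) ≡⟨ solve 4 (λ a b c d → a :* b :* (c :* d) := (a :* c) :* b :* d)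
                                                 refl (ι (suc e)) u (ι (suc n)) (1/suc n) ⟩
      (ι (suc e) * ι (suc n)) * u * 1/suc n ≡⟨ cong (λ z → z * u * 1/suc n) (ι-* (suc e) (suc n)) ⟨
      ι (suc e ℕ.* suc n) * u * 1/suc n     ≡⟨ cong (_* 1/suc n) (ι-suc*1/suc (n ℕ.+ e ℕ.* suc n)) ⟩
      1ℚ * 1/suc n                          ≡⟨ ℚ.*-identityˡ _ ⟩
      1/suc n                               ∎
      where
      open ≤-Reasoning
      u = 1/suc (n ℕ.+ e ℕ.* suc n)

    lower : f 0 ≤ rsum g (suc e)
    lower = subst (_≤ rsum g (suc e))
      (trans (ι-1/ (suc m)) (sym (trans (f≡ 0) (cong (λ k → 1/suc (suc k)) (ℕ.+-identityʳ m)))))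
      (rsum-lower g (suc e) _ λ j j≤e → subst (_ ≤_) (sym (f≡ (K ℕ.+ j)))
        (1/suc-anti (s≤s (ℕ.+-monoʳ-≤ m
          (subst (K ℕ.+ j ℕ.≤_) (trans (ℕ.+-comm K e) (sym (ℕ.*-suc e (suc m))))
            (ℕ.+-monoʳ-≤ K (ℕ.≤-pred j≤e)))))))

    upper : rsum g (suc e) ≤ 1/suc m
    upper = subst (rsum g (suc e) ≤_) (ι-1/ m)
      (rsum-upper g (suc e) _ λ j _ → subst (_≤ _) (sym (f≡ (K ℕ.+ j)))
        (1/suc-anti (ℕ.m≤n⇒m≤1+n (ℕ.+-monoʳ-≤ m (ℕ.m≤m+n K j)))))

    T-step : T m ≤ T (suc m)
    T-step = begin
      T m                                   ≡⟨ solve 2 (λ a b → a := (a :+ b) :- b) refl (T m) (f 0) ⟩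
      (T m + f 0) - f 0                     ≤⟨ ℚ.+-monoˡ-≤ (- f 0) (ℚ.+-monoʳ-≤ (T m) lower) ⟩
      (T m + rsum g (suc e)) - f 0          ≡⟨ cong (_- f 0) balance ⟨
      (f 0 + T (suc m)) - f 0               ≡⟨ solve 2 (λ a b → (b :+ a) :- b := a) refl (T (suc m)) (f 0) ⟩
      T (suc m)                             ∎
      where open ≤-Reasoning

    T-step′ : T (suc m) + 1/suc (suc m) ≤ T m + 1/suc m
    T-step′ = begin
      T (suc m) + 1/suc (suc m)   ≡⟨ ℚ.+-comm (T (suc m)) _ ⟩
      1/suc (suc m) + T (suc m)   ≡⟨ cong (_+ T (suc m))
                                       (trans (f≡ 0) (cong (λ k → 1/suc (suc k)) (ℕ.+-identityʳ m))) ⟨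
      f 0 + T (suc m)             ≡⟨ balance ⟩
      T m + rsum g (suc e)        ≤⟨ ℚ.+-monoʳ-≤ (T m) upper ⟩
      T m + 1/suc m               ∎
      where open ≤-Reasoning

  T-mono : ∀ {m n} → m ℕ.≤′ n → T m ≤ T n
  T-mono (ℕ.≤′-reflexive refl) = ℚ.≤-refl
  T-mono {n = suc n} (ℕ.≤′-step m≤n) = ℚ.≤-trans (T-mono m≤n) (Step.T-step n)

  T-mono′ : ∀ {m n} → m ℕ.≤′ n → T n + 1/suc n ≤ T m + 1/suc m
  T-mono′ (ℕ.≤′-reflexive refl) = ℚ.≤-refl
  T-mono′ {n = suc n} (ℕ.≤′-step m≤n) = ℚ.≤-trans (Step.T-step′ n) (T-mono′ m≤n)

  riemannSum-cauchy : IsCauchy T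
  riemannSum-cauchy = one-sided _ λ ε 0<ε →
    let N , h = archimedean 0<ε
    in N , λ m n N≤m N≤n → begin-strict
      T m               <⟨ p<p+q (T m) (0<1/suc m) ⟩
      T m + 1/suc m     ≤⟨ T-mono′ (ℕ.≤⇒≤′ N≤m) ⟩
      T N + 1/suc N     <⟨ ℚ.+-monoʳ-< (T N) (h N ℕ.≤-refl) ⟩
      T N + ε           ≤⟨ ℚ.+-monoˡ-≤ ε (T-mono (ℕ.≤⇒≤′ N≤n)) ⟩
      T n + ε           ∎
    where open ≤-Reasoning

-- The natural logarithm of d, as the limit of these sums.
log : ℕ → ℝ
seq      (log d) = riemannSum d
isCauchy (log d) = Log-Lemmas.riemannSum-cauchy d

0<log : ∀ {d} → 2 ℕ.≤ d → 0ℝ <ℝ log d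
0<log {suc (suc k)} (s≤s (s≤s z≤n)) = mk< (riemannSum d 0) 0<T₀ 0 λ n _ →
  subst (_≤ riemannSum d n) (sym (ℚ.+-identityˡ _)) (T-mono {0} {n} (ℕ.≤⇒≤′ z≤n))
  where
  d = suc (suc k)
  open Log-Lemmas d
  0≤rsum : ∀ l → 0ℚ ≤ rsum (λ j → + 1 / (1 ℕ.+ suc j)) l
  0≤rsum zero    = ℚ.≤-refl
  0≤rsum (suc l) = ℚ.≤-trans (0≤rsum l) (p≤p+q _ (ℚ.<⇒≤ (0<1/suc (suc l))))
  0<T₀ : 0ℚ < riemannSum d 0
  0<T₀ = ℚ.≤-<-trans (0≤rsum (k ℕ.* 1)) (p<p+q _ (0<1/suc (suc (k ℕ.* 1))))

greatest : {P : ℕ → Set} → (∀ k → Dec (P k)) → ℕ → ℕ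
greatest P? zero    = zero
greatest P? (suc b) with P? (suc b)
... | yes _ = suc b
... | no  _ = greatest P? b

-- For q ≥ 0 and N = suc n, the largest k with (k/N)⁴ ≤ q; for q < 0 it is 0.
-- The search bound suffices because it is N·c with c = suc ∣ numerator of q ∣ > q.
rootNumerator : ℚ → ℕ → ℕ
rootNumerator q n =
  greatest (λ k → pow4 (+ k / suc n) ℚ.≤? q) (ℤ.∣ ↥ q ∣ ℕ.* suc n ℕ.+ suc n)

-- Opaque because conversion checking would otherwise unfold the gcds in _/_.
opaque
  rootApprox : ℚ → ℕ → ℚ
  rootApprox q n = + rootNumerator q n / suc n

module Root-Lemmas where

  open +-*-Solver

  greatest-holds : ∀ {P : ℕ → Set} (P? : ∀ k → Dec (P k)) b →
                   greatest P? b ≡ 0 ⊎ P (greatest P? b)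
  greatest-holds P? zero = inj₁ refl
  greatest-holds P? (suc b) with P? (suc b)
  ... | yes p = inj₂ p
  ... | no  _ = greatest-holds P? b

  greatest-max : ∀ {P : ℕ → Set} (P? : ∀ k → Dec (P k)) b k →
                 greatest P? b ℕ.< k → k ℕ.≤ b → ¬ P k
  greatest-max P? zero    zero () z≤n
  greatest-max P? (suc b) k g<k k≤1+b with P? (suc b)
  ... | yes _ = contradiction g<k (ℕ.≤⇒≯ k≤1+b)
  ... | no ¬p with ℕ.m≤n⇒m<n∨m≡n k≤1+b
  ...   | inj₁ k<1+b = greatest-max P? b k g<k (ℕ.≤-pred k<1+b)
  ...   | inj₂ refl  = ¬p

  0≤k/n : ∀ k n → 0ℚ ≤ + k / suc n
  0≤k/n k n = subst (0ℚ ≤_) (sym (k/n≡ k n)) (0≤p*q (0≤ι k) (ℚ.<⇒≤ (0<1/suc n)))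

  suc-k/n : ∀ k n → + suc k / suc n ≡ + k / suc n + 1/suc n
  suc-k/n k n = begin-equality
    + suc k / suc n             ≡⟨ k/n≡ (suc k) n ⟩
    ι (suc k) * 1/suc n         ≡⟨ cong (λ j → ι j * 1/suc n) (ℕ.+-comm 1 k) ⟩
    ι (k ℕ.+ 1) * 1/suc n       ≡⟨ cong (_* 1/suc n) (ι-+ k 1) ⟩
    (ι k + 1ℚ) * 1/suc n        ≡⟨ solve 2 (λ x b → (x :+ con 1ℚ) :* b := x :* b :+ b) refl (ι k) (1/suc n) ⟩
    ι k * 1/suc n + 1/suc n     ≡⟨ cong (_+ 1/suc n) (k/n≡ k n) ⟨
    + k / suc n + 1/suc n       ∎
    where open ≤-Reasoning

  grid-lower : ∀ (f : ℕ → ℚ) q b → f 0 ≡ 0ℚ →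
    ∀ y → f (greatest (λ k → pow4 (f k) ℚ.≤? q) b) ≡ y → y ≡ 0ℚ ⊎ pow4 y ≤ q
  grid-lower f q b f0≡0 _ refl
    with greatest-holds {λ k → pow4 (f k) ≤ q} (λ k → pow4 (f k) ℚ.≤? q) b
  ... | inj₁ eq = inj₁ (trans (cong f eq) f0≡0)
  ... | inj₂ le = inj₂ le

  grid-upper : ∀ (f : ℕ → ℚ) q b → (∀ k → b ℕ.≤ k → q < pow4 (f k)) →
    ∀ y → f (suc (greatest (λ k → pow4 (f k) ℚ.≤? q) b)) ≡ y → q < pow4 y
  grid-upper f q b h _ refl with ℕ.≤-total (suc (greatest (λ k → pow4 (f k) ℚ.≤? q) b)) b
  ... | inj₁ le = ℚ.≰⇒> (greatest-max {λ k → pow4 (f k) ≤ q} (λ k → pow4 (f k) ℚ.≤? q) b _ ℕ.≤-refl le)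
  ... | inj₂ ge = h _ ge

  large : ∀ n c k → suc n ℕ.* c ℕ.≤ k → ι c ≤ + k / suc n
  large n c k h = begin
    ι c                               ≡⟨ ℚ.*-identityˡ (ι c) ⟨
    1ℚ * ι c                          ≡⟨ cong (_* ι c) (ι-suc*1/suc n) ⟨
    ι (suc n) * 1/suc n * ι c         ≡⟨ solve 3 (λ a b c → a :* b :* c := (a :* c) :* b) refl
                                          (ι (suc n)) (1/suc n) (ι c) ⟩
    (ι (suc n) * ι c) * 1/suc n       ≡⟨ cong (_* 1/suc n) (ι-* (suc n) c) ⟨
    ι (suc n ℕ.* c) * 1/suc n         ≤⟨ ℚ.*-monoʳ-≤-nonNeg (1/suc n) {{nneg (ℚ.<⇒≤ (0<1/suc n))}}
                                          (ι-mono-≤ {suc n ℕ.* c} {k} h) ⟩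
    ι k * 1/suc n                     ≡⟨ k/n≡ k n ⟨
    + k / suc n                       ∎
    where open ≤-Reasoning

  beyond : ∀ q n k → ℤ.∣ ↥ q ∣ ℕ.* suc n ℕ.+ suc n ℕ.≤ k → q < pow4 (+ k / suc n)
  beyond q n k h = begin-strict
    q                     <⟨ q<ι q ⟩
    ι c                   ≤⟨ ≤pow4 (ι-mono-≤ {1} {c} (s≤s z≤n)) ⟩
    pow4 (ι c)            ≤⟨ pow4-mono (0≤ι c) (large n c k (subst (ℕ._≤ k) bound h)) ⟩
    pow4 (+ k / suc n)    ∎
    where
    open ≤-Reasoning
    c = suc ℤ.∣ ↥ q ∣
    bound : ℤ.∣ ↥ q ∣ ℕ.* suc n ℕ.+ suc n ≡ suc n ℕ.* c
    bound = trans (ℕ.+-comm (ℤ.∣ ↥ q ∣ ℕ.* suc n) (suc n)) (ℕ.*-comm c (suc n))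

  opaque
    unfolding rootApprox

    0≤rootApprox : ∀ q n → 0ℚ ≤ rootApprox q n
    0≤rootApprox q n = 0≤k/n (rootNumerator q n) n

    rootApprox-suc : ∀ q n → + suc (rootNumerator q n) / suc n ≡ rootApprox q n + 1/suc n
    rootApprox-suc q n = suc-k/n (rootNumerator q n) n

    rootApprox≡ : ∀ q n → + rootNumerator q n / suc n ≡ rootApprox q n
    rootApprox≡ q n = refl

  rootApprox-lower : ∀ q n → rootApprox q n ≡ 0ℚ ⊎ pow4 (rootApprox q n) ≤ q
  rootApprox-lower q n = grid-lower (λ k → + k / suc n) q (ℤ.∣ ↥ q ∣ ℕ.* suc n ℕ.+ suc n)
    (trans (k/n≡ 0 n) (ℚ.*-zeroˡ (1/suc n))) (rootApprox q n) (rootApprox≡ q n)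

  rootApprox-upper : ∀ q n → q < pow4 (rootApprox q n + 1/suc n)
  rootApprox-upper q n = grid-upper (λ k → + k / suc n) q (ℤ.∣ ↥ q ∣ ℕ.* suc n ℕ.+ suc n)
    (beyond q n) (rootApprox q n + 1/suc n) (rootApprox-suc q n)

  root-close : ∀ {a b r t u δ} → 0ℚ < δ → 0ℚ < u → 0ℚ ≤ t →
               r ≡ 0ℚ ⊎ pow4 r ≤ a → b < pow4 (t + u) → a < b + pow4 δ → u < δ →
               r < t + (δ + δ)
  root-close {a} {b} {r} {t} {u} {δ} 0<δ 0<u 0≤t lower upper a< u<δ with <⊎≥ r (t + (δ + δ))
  ... | inj₁ lt = lt
  ... | inj₂ ge = by lower
    where
    open ≤-Reasoning
    0<δ+δ : 0ℚ < δ + δ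
    0<δ+δ = 0<p+q 0<δ 0<δ
    0≤t+δ : 0ℚ ≤ t + δ
    0≤t+δ = ℚ.≤-trans 0≤t (p≤p+q t (ℚ.<⇒≤ 0<δ))
    by : r ≡ 0ℚ ⊎ pow4 r ≤ a → r < t + (δ + δ)
    by (inj₁ refl) = ℚ.<-≤-trans 0<δ+δ
      (subst (_≤ t + (δ + δ)) (ℚ.+-identityˡ (δ + δ)) (ℚ.+-monoˡ-≤ (δ + δ) 0≤t))
    by (inj₂ r⁴≤a) = contradiction absurd (ℚ.<-irrefl refl)
      where
      absurd : a < a
      absurd = begin-strict
        a                         <⟨ a< ⟩
        b + pow4 δ                <⟨ ℚ.+-monoˡ-< (pow4 δ) upper ⟩
        pow4 (t + u) + pow4 δ     ≤⟨ ℚ.+-monoˡ-≤ (pow4 δ) (pow4-mono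
                                        (ℚ.≤-trans 0≤t (p≤p+q t (ℚ.<⇒≤ 0<u)))
                                        (ℚ.+-monoʳ-≤ t (ℚ.<⇒≤ u<δ))) ⟩
        pow4 (t + δ) + pow4 δ     ≤⟨ pow4-super 0≤t+δ (ℚ.<⇒≤ 0<δ) ⟩
        pow4 (t + δ + δ)          ≡⟨ cong pow4 (ℚ.+-assoc t δ δ) ⟩
        pow4 (t + (δ + δ))        ≤⟨ pow4-mono (ℚ.≤-trans 0≤t (p≤p+q t (ℚ.<⇒≤ 0<δ+δ))) ge ⟩
        pow4 r                    ≤⟨ r⁴≤a ⟩
        a                         ∎

  rootApprox-cauchy : ∀ {x} → IsCauchy x → IsCauchy (λ n → rootApprox (x n) n)
  rootApprox-cauchy {x} cx = one-sided _ λ ε 0<ε →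
    let δ     = ε * ½
        0<δ   = 0<half 0<ε
        M , h = cx (pow4 δ) (0<pow4 0<δ)
        N , k = archimedean 0<δ
    in M ℕ.⊔ N , λ m n m≥ n≥ →
      subst (λ η → rootApprox (x m) m < rootApprox (x n) n + η) (halves ε)
        (root-close 0<δ (0<1/suc n) (0≤rootApprox (x n) n)
          (rootApprox-lower (x m) m) (rootApprox-upper (x n) n)
        (∣p-q∣<ε⇒p<q+ε (x m) (x n) (h m n (ℕ.m⊔n≤o⇒m≤o M N m≥) (ℕ.m⊔n≤o⇒m≤o M N n≥)))
        (k n (ℕ.m⊔n≤o⇒n≤o M N n≥)))

open Root-Lemmas

infix 8 _^¼

-- The fourth root of a nonnegative real; the junk value is 0 for x < 0.
_^¼ : ℝ → ℝ
seq      (x ^¼) n = rootApprox (seq x n) n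
isCauchy (x ^¼)   = rootApprox-cauchy {seq x} (isCauchy x)

0<^¼ : ∀ x → 0ℝ <ℝ x → 0ℝ <ℝ x ^¼
0<^¼ x (mk< δ 0<δ N h) = mk< (γ * ½) (0<half 0<γ) (N ℕ.⊔ M) λ n n≥ →
  subst (_≤ r n) (sym (ℚ.+-identityˡ _))
    (bound n (subst (_≤ seq x n) (ℚ.+-identityˡ δ) (h n (ℕ.m⊔n≤o⇒m≤o N M n≥)))
             (k n (ℕ.m⊔n≤o⇒n≤o N M n≥)))
  where
  r : ℕ → ℚ
  r n = rootApprox (seq x n) n
  choose : ∃ λ γ → 0ℚ < γ × pow4 γ ≤ δ
  choose with ℚ.≤-total δ 1ℚ
  ... | inj₁ δ≤1 = δ , 0<δ , pow4≤ (ℚ.<⇒≤ 0<δ) δ≤1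
  ... | inj₂ 1≤δ = 1ℚ , 0<1 , 1≤δ
  γ = proj₁ choose
  0<γ = proj₁ (proj₂ choose)
  γ⁴≤δ = proj₂ (proj₂ choose)
  M = proj₁ (archimedean (0<half 0<γ))
  k = proj₂ (archimedean (0<half 0<γ))
  bound : ∀ n → δ ≤ seq x n → 1/suc n < γ * ½ → γ * ½ ≤ r n
  bound n δ≤x 1/n< with <⊎≥ (r n) (γ * ½)
  ... | inj₂ le = le
  ... | inj₁ gt = contradiction absurd (ℚ.<-irrefl refl)
    where
    open ≤-Reasoning
    absurd : δ < δ
    absurd = begin-strict
      δ                       ≤⟨ δ≤x ⟩
      seq x n                 <⟨ rootApprox-upper (seq x n) n ⟩
      pow4 (r n + 1/suc n)    ≤⟨ pow4-mono (ℚ.≤-trans (0≤rootApprox (seq x n) n) (p≤p+q (r n) (ℚ.<⇒≤ (0<1/suc n))))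
                                   (ℚ.<⇒≤ (ℚ.+-mono-< gt 1/n<)) ⟩
      pow4 (γ * ½ + γ * ½)    ≡⟨ cong pow4 (halves γ) ⟩
      pow4 γ                  ≤⟨ γ⁴≤δ ⟩
      δ                       ∎

record SimpleGraph (n : ℕ) : Set where
  field
    adj      : Fin n → Fin n → Bool
    adj-sym  : ∀ i j → adj i j ≡ adj j i
    adj-irr  : ∀ i → adj i i ≡ false

open SimpleGraph public

Matrix : ℕ → Set
Matrix n = Fin n → Fin n → ℝ

∑ : ∀ {n} → Vector ℝ n → ℝ
∑ = foldr _+ℝ_ 0ℝ

adjacencyMatrix : ∀ {n} → SimpleGraph n → Matrix n
adjacencyMatrix G i j = if adj G i j then 1ℝ else 0ℝ

_·_ : ∀ {n} → Vector ℝ n → Vector ℝ n → ℝ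
x · y = ∑ (λ i → x i *ℝ y i)

Eigenspace : ∀ {n} → SimpleGraph n → ℝ → Pred (Vector ℝ n) 0ℓ
Eigenspace G μ x = ∀ i → adjacencyMatrix G i · x ≈ℝ μ *ℝ x i

Spec : ∀ {n} → SimpleGraph n → Pred ℝ 0ℓ
Spec G μ = ∃ λ x → Eigenspace G μ x × ¬ (∀ i → x i ≈ℝ 0ℝ)

Switching : ℕ → Set
Switching n = Fin n → Sign

signVector : ∀ {n} → Switching n → Vector ℝ n
signVector s i with s i
... | Sign.+ = 1ℝ
... | Sign.- = -ℝ 1ℝ

_^⊥ : ∀ {n} → Switching n → Pred (Vector ℝ n) 0ℓ
(s ^⊥) x = signVector s · x ≈ℝ 0ℝ

-- The main eigenvalues of the signed graph G^s in terms of G itself: x lies in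
-- the μ-eigenspace of A(G) iff D_s x lies in that of A(G^s) = D_s A(G) D_s, and
-- s · x = 1 · D_s x.  Hence ∣ MainSpec G s ∣≡ M says that M is M_*(s).
MainSpec : ∀ {n} → SimpleGraph n → Switching n → Pred ℝ 0ℓ
MainSpec G s μ = Spec G μ × Eigenspace G μ ⊈ s ^⊥

-- A set of reals has exactly k elements when Fin k is in bijection with it, its
-- elements being compared by _≈ℝ_ and not by their membership proofs.
∣_∣≡_ : Pred ℝ 0ℓ → ℕ → Set
∣ P ∣≡ k = ∃ λ (f : Fin k → ∃ P) → Bijective _≡_ (_≈ℝ_ on proj₁) f

-- For a uniformly random switching s, an eigenvalue fails to be main only if s is orthogonal to
-- a fixed eigenvector x.  If x has at least 2r nonzero entries, the Littlewood–Offord inequality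
-- bounds the probability of this by (2r choose r)/4ʳ = O(r^(-1/2)).  The other eigenvalues are
-- eigenvalues of 0/1 matrices of order p < 2r; such a matrix has at most p eigenvalues, so there
-- are at most 2^O(r²) of these.  With r a small multiple of √(log d) the latter number is
-- negligible against d/√r, and some s does at least as well as the average.

module Submission where

open import Defs
open import Algebra.Bundles using (CommutativeRing)
open import Axiom.ExcludedMiddle using (ExcludedMiddle)
open import Data.Fin.Base using (Fin; zero; suc)
open import Data.Product using (∃; ∃-syntax; _×_; _,_; proj₁; proj₂)
open import Data.Sum.Base using (_⊎_; inj₁; inj₂; [_,_]′)
open import Data.Vec.Functional using (Vector)
open import Function.Base using (_∘_; _on_)
open import Function.Definitions using (Bijective)
open import Level using (0ℓ)
open import Relation.Binary.Definitions using (Decidable)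
open import Relation.Nullary using (¬_; Dec; yes; no; contradiction; ¬?)
open import Relation.Nullary.Decidable.Core using (decidable-stable)
open import Relation.Unary using (_⊈_)

-- The exponent 1/4 balances two losses. An eigenvector restricted to its support stays an
-- eigenvector of the subgraph induced there, so the loss from small supports depends on r alone,
-- not on `n` or `G`; it permits r of order √(log d), and the loss d/√r from large supports is then
-- of order d/(log d)^(1/4). Littlewood-Offord for one target does not survive induction on the
-- number of entries: fixing a sign turns one target into two. It is therefore proved for finite
-- sets of targets. With k nonzero entries, the share of sign vectors hitting one of j targets is at
-- most the sum of the j largest binomial coefficients of row k, divided by 2^k. That sum also
-- counts the walks of length k from height j that stay positive, and fixing a sign reproduces the
-- walk recursion: j targets become a set of j+1 and a set of j-1. One target means height 1, whose
-- count for even k is the central coefficient. Probabilities are cross-multiplied inequalities in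
-- ℕ, and bounds with square roots are stated squared; reals serve for the eigenvectors and the last
-- estimate. Case distinctions on reals come from excluded middle.

-- The reals as a commutative ring with a strict order and classical trichotomy.

module RealLemmas where

  open import Data.Nat.Base as ℕ using (ℕ)
  import Data.Nat.Properties as ℕ
  open import Data.Rational.Base using (ℚ; 0ℚ; 1ℚ; ½; _+_; _*_; _-_; -_; ∣_∣; _≤_; _<_)
  import Data.Rational.Properties as ℚ
  open import Data.Rational.Solver using (module +-*-Solver)
  open import Relation.Binary.PropositionalEquality
    using (_≡_; refl; sym; trans; cong; subst)
  open ℚ-Lemmas
  open Cauchy-Lemmas using (bounded)

  open +-*-Solver
  open ℚ.≤-Reasoning

  Eventually : (ℕ → Set) → Set
  Eventually P = ∃ λ N → ∀ n → N ℕ.≤ n → P n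

  eventually-× : ∀ {P Q : ℕ → Set} → Eventually P → Eventually Q → Eventually (λ n → P n × Q n)
  eventually-× (M , p) (N , q) = M ℕ.⊔ N , λ n n≥ →
    p n (ℕ.m⊔n≤o⇒m≤o M N n≥) , q n (ℕ.m⊔n≤o⇒n≤o M N n≥)

  eventually-map : ∀ {P Q : ℕ → Set} → (∀ n → P n → Q n) → Eventually P → Eventually Q
  eventually-map f (N , p) = N , λ n n≥ → f n (p n n≥)

  -- Rational sequences tending to 0. The congruences for `_≈ℝ_` reduce to their closure under sums,
  -- negation and Cauchy multiples. A record, so that `a` can be inferred.
  record Null (a : ℕ → ℚ) : Set where
    constructor mkNull
    field
      small : ∀ ε → 0ℚ < ε → Eventually (λ n → ∣ a n ∣ < ε)

  open Null

  null-0 : ∀ {a} → (∀ n → a n ≡ 0ℚ) → Null a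
  null-0 {a} a≡0 = mkNull λ ε 0<ε → 0 , λ n _ → subst (λ q → ∣ q ∣ < ε) (sym (a≡0 n)) 0<ε

  null-neg : ∀ {a} → Null a → Null (λ n → - a n)
  null-neg {a} null = mkNull λ ε 0<ε →
    eventually-map (λ n → subst (_< ε) (sym (ℚ.∣-p∣≡∣p∣ (a n)))) (small null ε 0<ε)

  null-+ : ∀ {a b} → Null a → Null b → Null (λ n → a n + b n)
  null-+ {a} {b} na nb = mkNull λ ε 0<ε → eventually-map
    (λ n (a< , b<) → subst (∣ a n + b n ∣ <_) (halves ε)
      (ℚ.≤-<-trans (ℚ.∣p+q∣≤∣p∣+∣q∣ (a n) (b n)) (ℚ.+-mono-< a< b<)))
    (eventually-× (small na (ε * ½) (0<half 0<ε)) (small nb (ε * ½) (0<half 0<ε)))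

  null-* : ∀ {a} b → IsCauchy b → Null a → Null (λ n → b n * a n)
  null-* {a} b cb na = mkNull λ ε 0<ε →
    let K , 0<K , bnd = bounded {b} cb
    in eventually-map
      (λ n (b≤ , a<) → begin-strict
        ∣ b n * a n ∣        ≡⟨ ℚ.∣p*q∣≡∣p∣*∣q∣ (b n) (a n) ⟩
        ∣ b n ∣ * ∣ a n ∣    ≤⟨ ℚ.*-monoʳ-≤-nonNeg ∣ a n ∣ {{nneg (ℚ.0≤∣p∣ (a n))}} b≤ ⟩
        K * ∣ a n ∣          <⟨ ℚ.*-monoʳ-<-pos K {{pos 0<K}} a< ⟩
        K * (recip K * ε)    ≡⟨ solve 3 (λ k r e → k :* (r :* e) := (r :* k) :* e) refl K (recip K) ε ⟩
        (recip K * K) * ε    ≡⟨ cong (_* ε) (recip-inverse 0<K) ⟩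
        1ℚ * ε               ≡⟨ ℚ.*-identityˡ ε ⟩
        ε                    ∎)
      (eventually-× bnd (small na (recip K * ε) (0<p*q (0<recip 0<K) 0<ε)))

  diff : ℝ → ℝ → ℕ → ℚ
  diff x y n = seq x n - seq y n

  ≈⇒null : ∀ {x y} → x ≈ℝ y → Null (diff x y)
  ≈⇒null (mk≈ h) = mkNull h

  null⇒≈ : ∀ {x y a} → (∀ n → a n ≡ diff x y n) → Null a → x ≈ℝ y
  null⇒≈ a≡diff null = mk≈ λ ε 0<ε →
    eventually-map (λ n → subst (λ q → ∣ q ∣ < ε) (a≡diff n)) (small null ε 0<ε)

  pointwise : ∀ x y → (∀ n → seq x n ≡ seq y n) → x ≈ℝ y
  pointwise x y h = null⇒≈ {x} {y} (λ _ → refl) (null-0 λ n →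
    trans (cong (_- seq y n) (h n)) (ℚ.+-inverseʳ (seq y n)))

  ≈-refl : ∀ {x} → x ≈ℝ x
  ≈-refl {x} = pointwise x x λ _ → refl

  ≈-sym : ∀ {x y} → x ≈ℝ y → y ≈ℝ x
  ≈-sym {x} {y} h = null⇒≈
    (λ n → solve 2 (λ a b → :- (a :- b) := b :- a) refl (seq x n) (seq y n))
    (null-neg (≈⇒null h))

  ≈-trans : ∀ {x y z} → x ≈ℝ y → y ≈ℝ z → x ≈ℝ z
  ≈-trans {x} {y} {z} h k = null⇒≈
    (λ n → solve 3 (λ a b c → (a :- b) :+ (b :- c) := a :- c) refl (seq x n) (seq y n) (seq z n))
    (null-+ (≈⇒null h) (≈⇒null k))

  +-cong : ∀ {x y u v} → x ≈ℝ y → u ≈ℝ v → x +ℝ u ≈ℝ y +ℝ v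
  +-cong {x} {y} {u} {v} h k = null⇒≈
    (λ n → solve 4 (λ a b c d → (a :- b) :+ (c :- d) := (a :+ c) :- (b :+ d)) refl
      (seq x n) (seq y n) (seq u n) (seq v n))
    (null-+ (≈⇒null h) (≈⇒null k))

  *-cong : ∀ {x y u v} → x ≈ℝ y → u ≈ℝ v → x *ℝ u ≈ℝ y *ℝ v
  *-cong {x} {y} {u} {v} h k = null⇒≈
    (λ n → solve 4 (λ a b c d → a :* (c :- d) :+ d :* (a :- b) := (a :* c) :- (b :* d)) refl
      (seq x n) (seq y n) (seq u n) (seq v n))
    (null-+ (null-* (seq x) (isCauchy x) (≈⇒null k)) (null-* (seq v) (isCauchy v) (≈⇒null h)))

  neg-cong : ∀ {x y} → x ≈ℝ y → -ℝ x ≈ℝ -ℝ y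
  neg-cong {x} {y} h = null⇒≈
    (λ n → solve 2 (λ a b → :- (a :- b) := (:- a) :- (:- b)) refl (seq x n) (seq y n))
    (null-neg (≈⇒null h))

  +-assoc : ∀ x y z → (x +ℝ y) +ℝ z ≈ℝ x +ℝ (y +ℝ z)
  +-assoc x y z = pointwise ((x +ℝ y) +ℝ z) (x +ℝ (y +ℝ z)) λ n → ℚ.+-assoc (seq x n) (seq y n) (seq z n)

  +-identityˡ : ∀ x → 0ℝ +ℝ x ≈ℝ x
  +-identityˡ x = pointwise (0ℝ +ℝ x) (x) λ n → ℚ.+-identityˡ (seq x n)

  +-identityʳ : ∀ x → x +ℝ 0ℝ ≈ℝ x
  +-identityʳ x = pointwise (x +ℝ 0ℝ) (x) λ n → ℚ.+-identityʳ (seq x n)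

  +-inverseˡ : ∀ x → (-ℝ x) +ℝ x ≈ℝ 0ℝ
  +-inverseˡ x = pointwise ((-ℝ x) +ℝ x) (0ℝ) λ n → ℚ.+-inverseˡ (seq x n)

  +-inverseʳ : ∀ x → x +ℝ (-ℝ x) ≈ℝ 0ℝ
  +-inverseʳ x = pointwise (x +ℝ (-ℝ x)) (0ℝ) λ n → ℚ.+-inverseʳ (seq x n)

  +-comm : ∀ x y → x +ℝ y ≈ℝ y +ℝ x
  +-comm x y = pointwise (x +ℝ y) (y +ℝ x) λ n → ℚ.+-comm (seq x n) (seq y n)

  *-assoc : ∀ x y z → (x *ℝ y) *ℝ z ≈ℝ x *ℝ (y *ℝ z)
  *-assoc x y z = pointwise ((x *ℝ y) *ℝ z) (x *ℝ (y *ℝ z)) λ n → ℚ.*-assoc (seq x n) (seq y n) (seq z n)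

  *-identityˡ : ∀ x → 1ℝ *ℝ x ≈ℝ x
  *-identityˡ x = pointwise (1ℝ *ℝ x) (x) λ n → ℚ.*-identityˡ (seq x n)

  *-identityʳ : ∀ x → x *ℝ 1ℝ ≈ℝ x
  *-identityʳ x = pointwise (x *ℝ 1ℝ) (x) λ n → ℚ.*-identityʳ (seq x n)

  *-distribˡ-+ : ∀ x y z → x *ℝ (y +ℝ z) ≈ℝ x *ℝ y +ℝ x *ℝ z
  *-distribˡ-+ x y z = pointwise (x *ℝ (y +ℝ z)) (x *ℝ y +ℝ x *ℝ z) λ n → ℚ.*-distribˡ-+ (seq x n) (seq y n) (seq z n)

  *-distribʳ-+ : ∀ x y z → (y +ℝ z) *ℝ x ≈ℝ y *ℝ x +ℝ z *ℝ x
  *-distribʳ-+ x y z = pointwise ((y +ℝ z) *ℝ x) (y *ℝ x +ℝ z *ℝ x) λ n → ℚ.*-distribʳ-+ (seq x n) (seq y n) (seq z n)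

  *-comm : ∀ x y → x *ℝ y ≈ℝ y *ℝ x
  *-comm x y = pointwise (x *ℝ y) (y *ℝ x) λ n → ℚ.*-comm (seq x n) (seq y n)

  ℝ-commutativeRing : CommutativeRing 0ℓ 0ℓ
  ℝ-commutativeRing = record
    { Carrier = ℝ
    ; _≈_     = _≈ℝ_
    ; _+_     = _+ℝ_
    ; _*_     = _*ℝ_
    ; -_      = -ℝ_
    ; 0#      = 0ℝ
    ; 1#      = 1ℝ
    ; isCommutativeRing = record
      { isRing = record
        { +-isAbelianGroup = record
          { isGroup = record
            { isMonoid = record
              { isSemigroup = record
                { isMagma = record
                  { isEquivalence = record { refl = ≈-refl ; sym = ≈-sym ; trans = ≈-trans }
                  ; ∙-cong        = +-cong
                  }
                ; assoc = +-assoc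
                }
              ; identity = +-identityˡ , +-identityʳ
              }
            ; inverse = +-inverseˡ , +-inverseʳ
            ; ⁻¹-cong = neg-cong
            }
          ; comm = +-comm
          }
        ; *-cong     = *-cong
        ; *-assoc    = *-assoc
        ; *-identity = *-identityˡ , *-identityʳ
        ; distrib    = *-distribˡ-+ , *-distribʳ-+
        }
      ; *-comm = *-comm
      }
    }

  <ℝ-irrefl : ∀ {x y} → x ≈ℝ y → ¬ x <ℝ y
  <ℝ-irrefl {x} {y} x≈y (mk< δ 0<δ N h) = ℚ.<-irrefl {seq x n + δ} refl (begin-strict
    seq x n + δ   ≤⟨ h n (ℕ.m≤m⊔n N M) ⟩
    seq y n       <⟨ ∣p-q∣<ε⇒p<q+ε (seq y n) (seq x n) {δ} (proj₂ near n (ℕ.m≤n⊔m N M)) ⟩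
    seq x n + δ   ∎)
    where
    near = _≈ℝ_.close (≈-sym x≈y) δ 0<δ
    M = proj₁ near
    n = N ℕ.⊔ M

  <ℝ-trans : ∀ {x y z} → x <ℝ y → y <ℝ z → x <ℝ z
  <ℝ-trans {x} {y} {z} (mk< δ 0<δ M h) (mk< η 0<η N k) = mk< δ 0<δ (M ℕ.⊔ N) λ n n≥ → begin
    seq x n + δ   ≤⟨ h n (ℕ.m⊔n≤o⇒m≤o M N n≥) ⟩
    seq y n       ≤⟨ p≤p+q (seq y n) (ℚ.<⇒≤ 0<η) ⟩
    seq y n + η   ≤⟨ k n (ℕ.m⊔n≤o⇒n≤o M N n≥) ⟩
    seq z n       ∎

  +-monoˡ-<ℝ : ∀ z {x y} → x <ℝ y → x +ℝ z <ℝ y +ℝ z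
  +-monoˡ-<ℝ z {x} {y} (mk< δ 0<δ N h) = mk< δ 0<δ N λ n n≥ → begin
    (seq x n + seq z n) + δ   ≡⟨ solve 3 (λ a b c → (a :+ c) :+ b := (a :+ b) :+ c) refl (seq x n) δ (seq z n) ⟩
    (seq x n + δ) + seq z n   ≤⟨ ℚ.+-monoˡ-≤ (seq z n) (h n n≥) ⟩
    seq y n + seq z n         ∎

  -- If neither strict inequality holds, x is close to 0: a single term at least ε beyond the ε/2
  -- Cauchy index would keep all later terms at least ε/2 and so give 0 < x; likewise below.
  trichotomy : ExcludedMiddle 0ℓ → ∀ x → x <ℝ 0ℝ ⊎ x ≈ℝ 0ℝ ⊎ 0ℝ <ℝ x
  trichotomy em x with em {x <ℝ 0ℝ} | em {0ℝ <ℝ x}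
  ... | yes x<0 | _       = inj₁ x<0
  ... | no  _   | yes 0<x = inj₂ (inj₂ 0<x)
  ... | no  x≮0 | no  0≮x = inj₂ (inj₁ (mk≈ λ ε 0<ε →
    let N , close = isCauchy x (ε * ½) (0<half 0<ε)
    in N , λ n N≤n → both⇒∣p-q∣<ε (seq x n) 0ℚ {ε}
      (bound-above ε 0<ε N n N≤n close) (bound-below ε 0<ε N n N≤n close)))
    where
    bound-above : ∀ ε → 0ℚ < ε → ∀ N n → N ℕ.≤ n →
      (∀ k l → N ℕ.≤ k → N ℕ.≤ l → ∣ seq x k - seq x l ∣ < ε * ½) → seq x n < 0ℚ + ε
    bound-above ε 0<ε N n N≤n close with <⊎≥ (seq x n) (0ℚ + ε)
    ... | inj₁ lt = lt
    ... | inj₂ ge = contradiction (mk< (ε * ½) (0<half 0<ε) N λ m N≤m → begin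
      0ℚ + ε * ½                  ≡⟨ solve 1 (λ e → con 0ℚ :+ e :* con ½ := (con 0ℚ :+ e) :- e :* con ½) refl ε ⟩
      (0ℚ + ε) - ε * ½            ≤⟨ ℚ.+-monoˡ-≤ (- (ε * ½)) ge ⟩
      seq x n - ε * ½             ≤⟨ ℚ.+-monoˡ-≤ (- (ε * ½)) (ℚ.<⇒≤
                                       (∣p-q∣<ε⇒p<q+ε (seq x n) (seq x m) {ε * ½} (close n m N≤n N≤m))) ⟩
      (seq x m + ε * ½) - ε * ½   ≡⟨ solve 2 (λ a b → (a :+ b) :- b := a) refl (seq x m) (ε * ½) ⟩
      seq x m                     ∎) 0≮x

    bound-below : ∀ ε → 0ℚ < ε → ∀ N n → N ℕ.≤ n →
      (∀ k l → N ℕ.≤ k → N ℕ.≤ l → ∣ seq x k - seq x l ∣ < ε * ½) → 0ℚ < seq x n + ε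
    bound-below ε 0<ε N n N≤n close with <⊎≥ 0ℚ (seq x n + ε)
    ... | inj₁ lt = lt
    ... | inj₂ ge = contradiction (mk< (ε * ½) (0<half 0<ε) N λ m N≤m → begin
      seq x m + ε * ½             ≤⟨ ℚ.+-monoˡ-≤ (ε * ½) (ℚ.<⇒≤
                                       (∣p-q∣<ε⇒p<q+ε (seq x m) (seq x n) {ε * ½} (close m n N≤m N≤n))) ⟩
      (seq x n + ε * ½) + ε * ½   ≡⟨ ℚ.+-assoc (seq x n) (ε * ½) (ε * ½) ⟩
      seq x n + (ε * ½ + ε * ½)   ≡⟨ cong (seq x n +_) (halves ε) ⟩
      seq x n + ε                 ≤⟨ ge ⟩
      0ℚ                          ∎) x≮0

  *-pos : ∀ {x y} → 0ℝ <ℝ x → 0ℝ <ℝ y → 0ℝ <ℝ x *ℝ y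
  *-pos {x} {y} (mk< δ 0<δ M h) (mk< η 0<η N k) = mk< (δ * η) (0<p*q 0<δ 0<η) (M ℕ.⊔ N) λ n n≥ → begin
    0ℚ + δ * η                ≡⟨ solve 2 (λ a b → con 0ℚ :+ a :* b := (con 0ℚ :+ a) :* (con 0ℚ :+ b)) refl δ η ⟩
    (0ℚ + δ) * (0ℚ + η)       ≤⟨ *-mono-≤ (0≤0+ 0<δ) (ℚ.≤-trans (0≤0+ 0<η) (k n (ℕ.m⊔n≤o⇒n≤o M N n≥)))
                                   (h n (ℕ.m⊔n≤o⇒m≤o M N n≥)) (k n (ℕ.m⊔n≤o⇒n≤o M N n≥)) ⟩
    seq x n * seq y n         ∎
    where
    0≤0+ : ∀ {p} → 0ℚ < p → 0ℚ ≤ 0ℚ + p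
    0≤0+ 0<p = p≤p+q 0ℚ (ℚ.<⇒≤ 0<p)

  -- This and its mirror image for negative x order the two targets that arise from t when the sign
  -- of the entry x is fixed.
  0<x⇒t-x<t+x : ∀ t {x} → 0ℝ <ℝ x → t -ℝ x <ℝ t +ℝ x
  0<x⇒t-x<t+x t {x} (mk< δ 0<δ N h) = mk< δ 0<δ N λ n n≥ →
    ineq (seq t n) (seq x n) (subst (_≤ seq x n) (ℚ.+-identityˡ δ) (h n n≥))
    where
    ineq : ∀ t x → δ ≤ x → (t - x) + δ ≤ t + x
    ineq t x δ≤x = begin
      (t - x) + δ   ≤⟨ ℚ.+-monoʳ-≤ (t - x) δ≤x ⟩
      (t - x) + x   ≡⟨ solve 2 (λ t x → (t :- x) :+ x := t) refl t x ⟩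
      t             ≤⟨ p≤p+q t (ℚ.≤-trans (ℚ.<⇒≤ 0<δ) δ≤x) ⟩
      t + x         ∎

  x<0⇒t+x<t-x : ∀ t {x} → x <ℝ 0ℝ → t +ℝ x <ℝ t -ℝ x
  x<0⇒t+x<t-x t {x} (mk< δ 0<δ N h) = mk< δ 0<δ N λ n n≥ → ineq (seq t n) (seq x n) (h n n≥)
    where
    ineq : ∀ t x → x + δ ≤ 0ℚ → (t + x) + δ ≤ t - x
    ineq t x x+δ≤0 = begin
      (t + x) + δ   ≡⟨ ℚ.+-assoc t x δ ⟩
      t + (x + δ)   ≤⟨ ℚ.+-monoʳ-≤ t (ℚ.≤-trans x+δ≤0 0≤-x) ⟩
      t + (- x)     ∎
      where
      0≤-x : 0ℚ ≤ - x
      0≤-x = ℚ.neg-antimono-≤ (ℚ.≤-trans (p≤p+q x (ℚ.<⇒≤ 0<δ)) x+δ≤0)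

  x<0⇒0<-x : ∀ {x} → x <ℝ 0ℝ → 0ℝ <ℝ -ℝ x
  x<0⇒0<-x {x} (mk< δ 0<δ N h) = mk< δ 0<δ N λ n n≥ → ineq (seq x n) (h n n≥)
    where
    ineq : ∀ x → x + δ ≤ 0ℚ → 0ℚ + δ ≤ - x
    ineq x x+δ≤0 = begin
      0ℚ + δ          ≡⟨ solve 2 (λ x d → con 0ℚ :+ d := (x :+ d) :- x) refl x δ ⟩
      (x + δ) - x     ≤⟨ ℚ.+-monoˡ-≤ (- x) x+δ≤0 ⟩
      0ℚ + (- x)      ≡⟨ ℚ.+-identityˡ (- x) ⟩
      - x             ∎

  1≉0 : ¬ 1ℝ ≈ℝ 0ℝ
  1≉0 1≈0 = <ℝ-irrefl {0ℝ} {1ℝ} (≈-sym 1≈0) (mk< 1ℚ 0<1 0 λ _ _ → ℚ.≤-refl)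

  -- Takes the place of inverses in the linear algebra. A product of two nonzero reals has a strict
  -- sign, determined by the signs of the factors.
  noZeroDivisors : ExcludedMiddle 0ℓ → ∀ x y → x *ℝ y ≈ℝ 0ℝ → x ≈ℝ 0ℝ ⊎ y ≈ℝ 0ℝ
  noZeroDivisors em x y xy≈0 with trichotomy em x | trichotomy em y
  ... | inj₂ (inj₁ x≈0) | _               = inj₁ x≈0
  ... | _               | inj₂ (inj₁ y≈0) = inj₂ y≈0
  ... | inj₁ x<0        | inj₁ y<0        = contradiction (*-pos (x<0⇒0<-x x<0) (x<0⇒0<-x y<0))
    (<ℝ-irrefl (≈-sym (≈-trans (pointwise ((-ℝ x) *ℝ (-ℝ y)) (x *ℝ y)
      λ n → solve 2 (λ a b → (:- a) :* (:- b) := a :* b) refl (seq x n) (seq y n)) xy≈0)))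
  ... | inj₁ x<0        | inj₂ (inj₂ 0<y) = contradiction (*-pos (x<0⇒0<-x x<0) 0<y)
    (<ℝ-irrefl (≈-sym (≈-trans (pointwise ((-ℝ x) *ℝ y) (-ℝ (x *ℝ y))
      λ n → solve 2 (λ a b → (:- a) :* b := :- (a :* b)) refl (seq x n) (seq y n)) -xy≈0)))
    where
    -xy≈0 : -ℝ (x *ℝ y) ≈ℝ 0ℝ
    -xy≈0 = ≈-trans (neg-cong xy≈0) (pointwise (-ℝ 0ℝ) 0ℝ λ _ → refl)
  ... | inj₂ (inj₂ 0<x) | inj₁ y<0        = contradiction (*-pos 0<x (x<0⇒0<-x y<0))
    (<ℝ-irrefl (≈-sym (≈-trans (pointwise (x *ℝ (-ℝ y)) (-ℝ (x *ℝ y))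
      λ n → solve 2 (λ a b → a :* (:- b) := :- (a :* b)) refl (seq x n) (seq y n)) -xy≈0)))
    where
    -xy≈0 : -ℝ (x *ℝ y) ≈ℝ 0ℝ
    -xy≈0 = ≈-trans (neg-cong xy≈0) (pointwise (-ℝ 0ℝ) 0ℝ λ _ → refl)
  ... | inj₂ (inj₂ 0<x) | inj₂ (inj₂ 0<y) = contradiction (*-pos 0<x 0<y) (<ℝ-irrefl (≈-sym xy≈0))

-- At most m eigenvalues for an m × m matrix, over an integral domain with decidable equality.

module LinearAlgebra (R : CommutativeRing 0ℓ 0ℓ)
  (_≟_ : Decidable (CommutativeRing._≈_ R))
  (noZeroDivisors : ∀ x y → CommutativeRing._≈_ R (CommutativeRing._*_ R x y) (CommutativeRing.0# R) →
    CommutativeRing._≈_ R x (CommutativeRing.0# R) ⊎ CommutativeRing._≈_ R y (CommutativeRing.0# R))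
  (1≉0 : ¬ CommutativeRing._≈_ R (CommutativeRing.1# R) (CommutativeRing.0# R))
  where

  open import Data.Fin.Base using (punchIn)
  open import Data.Fin.Properties using (any?; suc-injective)
  open import Data.Nat.Base using (zero; suc)
  open import Data.Vec.Functional using (insertAt; _∷_)
  open import Data.Vec.Functional.Properties using (insertAt-lookup; insertAt-punchIn)
  open import Relation.Binary.PropositionalEquality using (_≡_)

  open CommutativeRing R hiding (zero)
  open import Algebra.Properties.Semiring.Sum semiring
  open import Algebra.Properties.Ring ring
  open import Relation.Binary.Reasoning.Setoid setoid

  private
    sum-zero : ∀ {n} (f : Vector Carrier n) → (∀ i → f i ≈ 0#) → sum f ≈ 0#
    sum-zero {n} f f≈0 = trans (sum-cong-≋ f≈0) (sum-replicate-zero n)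

    sum-neg : ∀ {n} (f : Vector Carrier n) → - sum f ≈ sum (λ i → - f i)
    sum-neg f = begin
      - sum f                  ≈⟨ -1*x≈-x (sum f) ⟨
      - 1# * sum f             ≈⟨ *-distribˡ-sum (- 1#) f ⟩
      sum (λ i → - 1# * f i)   ≈⟨ sum-cong-≋ (λ i → -1*x≈-x (f i)) ⟩
      sum (λ i → - f i)        ∎

    sum-minus : ∀ {n} (f g : Vector Carrier n) → sum f - sum g ≈ sum (λ i → f i - g i)
    sum-minus f g = trans (+-congˡ (sum-neg g)) (sym (∑-distrib-+ f (λ i → - g i)))

  -- Gaussian elimination by induction on the dimension: each round removes coordinate `zero` and
  -- one vector.
  dependence : ∀ k (v : Fin (suc k) → Vector Carrier k) →
    ∃ λ (c : Vector Carrier (suc k)) → (∃ λ i → ¬ c i ≈ 0#) × (∀ a → sum (λ i → c i * v i a) ≈ 0#)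
  dependence zero    v = (λ _ → 1#) , (zero , 1≉0) , λ ()
  dependence (suc k) v with any? (λ i → ¬? (v i zero ≟ 0#))
  -- Coordinate `zero` vanishes on all vectors, so a relation among the others in the remaining
  -- coordinates suffices and vector `zero` gets coefficient `0#`.
  ... | no noPivot = 0# ∷ c , (suc (proj₁ nonzero) , proj₂ nonzero) , vanishes
    where
    ih = dependence k (λ i a → v (suc i) (suc a))
    c = proj₁ ih
    nonzero = proj₁ (proj₂ ih)

    vanishes : ∀ a → sum (λ i → (0# ∷ c) i * v i a) ≈ 0#
    vanishes zero    = sum-zero (λ i → (0# ∷ c) i * v i zero) λ i →
      trans (*-congˡ (decidable-stable (v i zero ≟ 0#) λ v≉0 → noPivot (i , v≉0))) (zeroʳ _)
    vanishes (suc a) = trans (+-cong (zeroˡ _) (proj₂ (proj₂ ih) a)) (+-identityʳ 0#)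
  ... | yes (p , pivot≉0) = insertAt c′ p c₀ , (punchIn p (proj₁ nonzero) , c′≉0) , vanishes
    where
    -- Elimination with cross-multiplication in place of division.
    u : Fin (suc k) → Vector Carrier (suc k)
    u j a = v p zero * v (punchIn p j) a - v (punchIn p j) zero * v p a

    ih = dependence k (λ j a → u j (suc a))
    c = proj₁ ih
    nonzero = proj₁ (proj₂ ih)

    -- The coefficients found by expanding each `u j` in the relation between them: `c′` collects on
    -- the other vectors and `c₀` on the pivot vector. The nonzero `c j` survives because the pivot
    -- is nonzero.
    c′ : Vector Carrier (suc k)
    c′ j = c j * v p zero
    c₀ : Carrier
    c₀ = - sum (λ j → c j * v (punchIn p j) zero)

    c′≉0 : ¬ insertAt c′ p c₀ (punchIn p (proj₁ nonzero)) ≈ 0#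
    c′≉0 c′≈0 with noZeroDivisors _ _ (trans (sym (reflexive (insertAt-punchIn c′ p c₀ (proj₁ nonzero)))) c′≈0)
    ... | inj₁ c≈0 = proj₂ nonzero c≈0
    ... | inj₂ v≈0 = pivot≉0 v≈0

    cu : ∀ a → sum (λ j → c j * u j a) ≈ 0#
    cu zero    = sum-zero (λ j → c j * u j zero) λ j → trans
      (*-congˡ (trans (+-congˡ (-‿cong (*-comm _ _))) (-‿inverseʳ _))) (zeroʳ (c j))
    cu (suc a) = proj₂ (proj₂ ih) a

    vanishes : ∀ a → sum (λ i → insertAt c′ p c₀ i * v i a) ≈ 0#
    vanishes a = begin
      sum (λ i → insertAt c′ p c₀ i * v i a)
        ≈⟨ sum-remove {i = p} (λ i → insertAt c′ p c₀ i * v i a) ⟩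
      insertAt c′ p c₀ p * v p a + sum (λ j → insertAt c′ p c₀ (punchIn p j) * v (punchIn p j) a)
        ≈⟨ +-cong (*-congʳ (reflexive (insertAt-lookup c′ p c₀)))
             (sum-cong-≋ λ j → *-congʳ {v (punchIn p j) a} (reflexive (insertAt-punchIn c′ p c₀ j))) ⟩
      c₀ * v p a + sum (λ j → c′ j * v (punchIn p j) a)
        ≈⟨ +-comm (c₀ * v p a) (sum (λ j → c′ j * v (punchIn p j) a)) ⟩
      sum (λ j → c′ j * v (punchIn p j) a) + c₀ * v p a
        ≈⟨ +-congˡ (trans (sym (-‿distribˡ-* _ _)) (-‿cong (*-distribʳ-sum (v p a) (λ j → c j * v (punchIn p j) zero)))) ⟩
      sum (λ j → c′ j * v (punchIn p j) a) - sum (λ j → c j * v (punchIn p j) zero * v p a)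
        ≈⟨ sum-minus (λ j → c′ j * v (punchIn p j) a) (λ j → c j * v (punchIn p j) zero * v p a) ⟩
      sum (λ j → c′ j * v (punchIn p j) a - c j * v (punchIn p j) zero * v p a)
        ≈⟨ sum-cong-≋ (λ j → trans
             (+-cong (*-assoc (c j) (v p zero) (v (punchIn p j) a))
               (-‿cong (*-assoc (c j) (v (punchIn p j) zero) (v p a))))
             (sym (x[y-z]≈xy-xz (c j) _ _))) ⟩
      sum (λ j → c j * u j a)
        ≈⟨ cu a ⟩
      0# ∎

  Eigenpair : ∀ {m} → (Fin m → Vector Carrier m) → Carrier → Vector Carrier m → Set
  Eigenpair B μ v = (∀ a → sum (λ b → B a b * v b) ≈ μ * v a) × ¬ (∀ a → v a ≈ 0#)

  -- Applying `B` to the relation and subtracting `μ zero` times the relation cancels the term of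
  -- `v zero`. Induction kills the coefficients c i * (μ i - μ zero) of the rest; distinctness
  -- removes the second factor, and a nonzero `v zero` then forces `c zero` to vanish.
  independence : ∀ {k m} (B : Fin m → Vector Carrier m) (μ : Vector Carrier k) →
    (∀ {i j} → μ i ≈ μ j → i ≡ j) →
    ∀ (v : Fin k → Vector Carrier m) → (∀ i → Eigenpair B (μ i) (v i)) →
    ∀ (c : Vector Carrier k) → (∀ a → sum (λ i → c i * v i a) ≈ 0#) → ∀ i → c i ≈ 0#
  independence {zero}  B μ μ-inj v eig c cv≈0 ()
  independence {suc k} B μ μ-inj v eig c cv≈0 = λ where
      zero    → c₀≈0
      (suc i) → tail≈0 i
    where
    BΣ : ∀ a → sum (λ i → c i * (μ i * v i a)) ≈ 0#
    BΣ a = begin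
      sum (λ i → c i * (μ i * v i a))
        ≈⟨ sum-cong-≋ (λ i → *-congˡ {c i} (proj₁ (eig i) a)) ⟨
      sum (λ i → c i * sum (λ b → B a b * v i b))
        ≈⟨ sum-cong-≋ (λ i → trans (*-distribˡ-sum (c i) (λ b → B a b * v i b))
             (sum-cong-≋ λ b → swap (c i) (B a b) (v i b))) ⟩
      sum (λ i → sum (λ b → B a b * (c i * v i b)))
        ≈⟨ ∑-comm (λ i b → B a b * (c i * v i b)) ⟩
      sum (λ b → sum (λ i → B a b * (c i * v i b)))
        ≈⟨ sum-cong-≋ (λ b → *-distribˡ-sum (B a b) (λ i → c i * v i b)) ⟨
      sum (λ b → B a b * sum (λ i → c i * v i b))
        ≈⟨ sum-zero (λ b → B a b * sum (λ i → c i * v i b)) (λ b → trans (*-congˡ (cv≈0 b)) (zeroʳ _)) ⟩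
      0# ∎
      where
      swap : ∀ x y z → x * (y * z) ≈ y * (x * z)
      swap x y z = trans (sym (*-assoc x y z)) (trans (*-congʳ (*-comm x y)) (*-assoc y x z))

    shifted : ∀ i a → c i * (μ i - μ zero) * v i a ≈ c i * (μ i * v i a) - μ zero * (c i * v i a)
    shifted i a = begin
      c i * (μ i - μ zero) * v i a                     ≈⟨ *-assoc _ _ _ ⟩
      c i * ((μ i - μ zero) * v i a)                   ≈⟨ *-congˡ ([y-z]x≈yx-zx (v i a) (μ i) (μ zero)) ⟩
      c i * (μ i * v i a - μ zero * v i a)             ≈⟨ x[y-z]≈xy-xz (c i) _ _ ⟩
      c i * (μ i * v i a) - c i * (μ zero * v i a)     ≈⟨ +-congˡ (-‿cong (trans (sym (*-assoc _ _ _))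
                                                           (trans (*-congʳ (*-comm _ _)) (*-assoc _ _ _)))) ⟩
      c i * (μ i * v i a) - μ zero * (c i * v i a)     ∎

    total : ∀ a → sum (λ i → c i * (μ i - μ zero) * v i a) ≈ 0#
    total a = begin
      sum (λ i → c i * (μ i - μ zero) * v i a)
        ≈⟨ sum-cong-≋ (λ i → shifted i a) ⟩
      sum (λ i → c i * (μ i * v i a) - μ zero * (c i * v i a))
        ≈⟨ sum-minus (λ i → c i * (μ i * v i a)) (λ i → μ zero * (c i * v i a)) ⟨
      sum (λ i → c i * (μ i * v i a)) - sum (λ i → μ zero * (c i * v i a))
        ≈⟨ +-cong (BΣ a) (-‿cong (trans (sym (*-distribˡ-sum (μ zero) (λ i → c i * v i a)))
             (trans (*-congˡ (cv≈0 a)) (zeroʳ (μ zero))))) ⟩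
      0# - 0#
        ≈⟨ -‿inverseʳ 0# ⟩
      0# ∎

    tail-vanishes : ∀ a → sum (λ i → c (suc i) * (μ (suc i) - μ zero) * v (suc i) a) ≈ 0#
    tail-vanishes a = begin
      rest                                          ≈⟨ +-identityˡ _ ⟨
      0# + rest                                     ≈⟨ +-congʳ (trans (*-congʳ (trans (*-congˡ (-‿inverseʳ _)) (zeroʳ _))) (zeroˡ _)) ⟨
      c zero * (μ zero - μ zero) * v zero a + rest  ≈⟨ total a ⟩
      0#                                            ∎
      where rest = sum (λ i → c (suc i) * (μ (suc i) - μ zero) * v (suc i) a)

    tail≈0 : ∀ i → c (suc i) ≈ 0#
    tail≈0 i with noZeroDivisors _ _ (independence B (μ ∘ suc) (λ eq → suc-injective (μ-inj eq)) (v ∘ suc) (eig ∘ suc)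
      (λ j → c (suc j) * (μ (suc j) - μ zero)) tail-vanishes i)
    ... | inj₁ c≈0   = c≈0
    ... | inj₂ μ-μ≈0 = contradiction (μ-inj (x∙y⁻¹≈ε⇒x≈y _ _ μ-μ≈0)) λ ()

    c₀v₀≈0 : ∀ a → c zero * v zero a ≈ 0#
    c₀v₀≈0 a = begin
      c zero * v zero a          ≈⟨ +-identityʳ _ ⟨
      c zero * v zero a + 0#     ≈⟨ +-congˡ (sum-zero (λ i → c (suc i) * v (suc i) a)
                                      (λ i → trans (*-congʳ (tail≈0 i)) (zeroˡ _))) ⟨
      sum (λ i → c i * v i a)    ≈⟨ cv≈0 a ⟩
      0#                         ∎

    c₀≈0 : c zero ≈ 0#
    c₀≈0 = decidable-stable (c zero ≟ 0#) λ c₀≉0 → proj₂ (eig zero) λ a →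
      [ (λ c≈0 → contradiction c≈0 c₀≉0) , (λ v≈0 → v≈0) ]′ (noZeroDivisors _ _ (c₀v₀≈0 a))

  ¬1+m-eigenvalues : ∀ {m} (B : Fin m → Vector Carrier m) (μ : Vector Carrier (suc m)) →
    (∀ {i j} → μ i ≈ μ j → i ≡ j) → ¬ (∀ i → ∃ (Eigenpair B (μ i)))
  ¬1+m-eigenvalues {m} B μ μ-inj eig =
    let c , (i , c≉0) , cv≈0 = dependence m (proj₁ ∘ eig)
    in c≉0 (independence B μ μ-inj (proj₁ ∘ eig) (proj₂ ∘ eig) c cv≈0 i)

-- Central binomial coefficients and walks that stay positive.

module Binomials where

  open import Algebra.Properties.CommutativeSemigroup using (interchange)
  open import Data.Nat.Base
  open import Data.Nat.Properties
  open import Data.Nat.Tactic.RingSolver using (solve-∀)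
  open import Relation.Binary.PropositionalEquality
    using (_≡_; refl; sym; trans; cong; cong₂)

  open ≤-Reasoning

  -- choose p q is the binomial coefficient (p+q choose p).
  choose : ℕ → ℕ → ℕ
  choose zero    q       = 1
  choose (suc p) zero    = 1
  choose (suc p) (suc q) = choose p (suc q) + choose (suc p) q

  choose-zeroʳ : ∀ p → choose p zero ≡ 1
  choose-zeroʳ zero    = refl
  choose-zeroʳ (suc p) = refl

  choose-! : ∀ p q → choose p q * (p ! * q !) ≡ (p + q) !
  choose-! zero    q       = trans (+-identityʳ (q ! + 0)) (+-identityʳ (q !))
  choose-! (suc p) zero    = trans (+-identityʳ _) (trans (*-identityʳ _) (cong (_!) (sym (+-identityʳ (suc p)))))
  choose-! (suc p) (suc q) = begin-equality
    (a + b) * ((suc p * p !) * (suc q * q !))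
      ≡⟨ split a b (suc p) (p !) (suc q) (q !) ⟩
    suc p * (a * (p ! * (suc q * q !))) + suc q * (b * ((suc p * p !) * q !))
      ≡⟨ cong₂ (λ x y → suc p * x + suc q * y)
           (trans (choose-! p (suc q)) (cong (_!) (+-suc p q))) (choose-! (suc p) q) ⟩
    suc p * (suc p + q) ! + suc q * (suc p + q) !
      ≡⟨ *-distribʳ-+ ((suc p + q) !) (suc p) (suc q) ⟨
    (suc p + suc q) * (suc p + q) !
      ≡⟨ cong (λ n → n * (suc p + q) !) (+-suc (suc p) q) ⟩
    (suc (suc p + q)) !
      ≡⟨ cong (_!) (+-suc (suc p) q) ⟨
    (suc p + suc q) ! ∎
    where
    a = choose p (suc q)
    b = choose (suc p) q
    split : ∀ a b m x n y → (a + b) * ((m * x) * (n * y)) ≡ m * (a * (x * (n * y))) + n * (b * ((m * x) * y))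
    split = solve-∀

  centralChoose : ∀ r → choose (suc r) (suc r) * suc r ≡ 2 * (2 * r + 1) * choose r r
  centralChoose r = *-cancelʳ-≡ _ _ (suc r * (r ! * r !)) {{m*n≢0 (suc r) _ {{it}} {{m*n≢0 (r !) (r !) {{r !≢0}} {{r !≢0}}}}}} (begin-equality
    C′ * suc r * (suc r * (r ! * r !))            ≡⟨ rearrange₁ C′ (suc r) (r !) ⟩
    C′ * ((suc r * r !) * (suc r * r !))          ≡⟨ choose-! (suc r) (suc r) ⟩
    (suc r + suc r) !                             ≡⟨ cong (λ n → (suc n) !) (+-suc r r) ⟩
    suc (suc (r + r)) * (suc (r + r) * (r + r) !) ≡⟨ cong (λ n → suc (suc (r + r)) * (suc (r + r) * n)) (choose-! r r) ⟨
    suc (suc (r + r)) * (suc (r + r) * (choose r r * (r ! * r !))) ≡⟨ rearrange₂ r (choose r r) (r ! * r !) ⟩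
    2 * (2 * r + 1) * choose r r * (suc r * (r ! * r !)) ∎)
    where
    open import Function.Base using (it)
    C′ = choose (suc r) (suc r)
    rearrange₁ : ∀ c s x → c * s * (s * (x * x)) ≡ c * ((s * x) * (s * x))
    rearrange₁ = solve-∀
    rearrange₂ : ∀ r c x → suc (suc (r + r)) * (suc (r + r) * (c * x)) ≡ 2 * (2 * r + 1) * c * (suc r * x)
    rearrange₂ = solve-∀

  -- The square of C(2r,r) ≤ 4^r / √(2r+1). The induction step comes down to 4(2r+1)(2r+3) =
  -- 16(r+1)² - 4.
  centralChoose-bound : ∀ r → choose r r * choose r r * (2 * r + 1) ≤ 16 ^ r
  centralChoose-bound zero    = ≤-refl
  centralChoose-bound (suc r) = *-cancelʳ-≤ _ _ (suc r * suc r) (begin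
    C′ * C′ * (2 * suc r + 1) * (suc r * suc r)                       ≡⟨ rearrange₁ C′ (suc r) ⟩
    (C′ * suc r) * (C′ * suc r) * (2 * suc r + 1)                     ≡⟨ cong (λ x → x * x * (2 * suc r + 1)) (centralChoose r) ⟩
    (2 * (2 * r + 1) * C) * (2 * (2 * r + 1) * C) * (2 * suc r + 1)   ≡⟨ rearrange₂ r C ⟩
    (C * C * (2 * r + 1)) * (16 * r * r + 32 * r + 12)                ≤⟨ *-mono-≤ (centralChoose-bound r) (m≤m+n (16 * r * r + 32 * r + 12) 4) ⟩
    16 ^ r * (16 * r * r + 32 * r + 12 + 4)                           ≡⟨ rearrange₃ r (16 ^ r) ⟩
    16 * 16 ^ r * (suc r * suc r)                                     ∎)
    where
    C = choose r r
    C′ = choose (suc r) (suc r)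
    rearrange₁ : ∀ c s → c * c * (2 * s + 1) * (s * s) ≡ (c * s) * (c * s) * (2 * s + 1)
    rearrange₁ = solve-∀
    rearrange₂ : ∀ r c → (2 * (2 * r + 1) * c) * (2 * (2 * r + 1) * c) * (2 * suc r + 1)
                         ≡ (c * c * (2 * r + 1)) * (16 * r * r + 32 * r + 12)
    rearrange₂ = solve-∀
    rearrange₃ : ∀ r x → x * (16 * r * r + 32 * r + 12 + 4) ≡ 16 * x * (suc r * suc r)
    rearrange₃ = solve-∀

  -- The number of ±1-walks of length m from height j that stay positive.
  walks : ℕ → ℕ → ℕ
  walks m       zero    = 0
  walks zero    (suc j) = 1
  walks (suc m) (suc j) = walks m (2 + j) + walks m j

  walks≤2^ : ∀ m j → walks m j ≤ 2 ^ m
  walks≤2^ m       zero    = z≤n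
  walks≤2^ zero    (suc j) = ≤-refl
  walks≤2^ (suc m) (suc j) = begin
    walks m (2 + j) + walks m j   ≤⟨ +-mono-≤ (walks≤2^ m (2 + j)) (walks≤2^ m j) ⟩
    2 ^ m + 2 ^ m                 ≡⟨ cong (2 ^ m +_) (+-identityʳ (2 ^ m)) ⟨
    2 * 2 ^ m                     ∎

  -- For n = p+q+j-1, the sum of the j consecutive binomial coefficients (n choose p+i), i < j.
  rowSum : ℕ → ℕ → ℕ → ℕ
  rowSum p q zero    = 0
  rowSum p q (suc j) = choose p (q + j) + rowSum (suc p) q j

  rowSum-snoc : ∀ p q j → rowSum p q (suc j) ≡ rowSum p (suc q) j + choose (p + j) q
  rowSum-snoc p q zero    = trans (+-identityʳ _) (cong₂ choose (sym (+-identityʳ p)) (+-identityʳ q))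
  rowSum-snoc p q (suc j) = begin-equality
    choose p (q + suc j) + rowSum (suc p) q (suc j)
      ≡⟨ cong₂ _+_ (cong (choose p) (+-suc q j)) (rowSum-snoc (suc p) q j) ⟩
    choose p (suc q + j) + (rowSum (suc p) (suc q) j + choose (suc p + j) q)
      ≡⟨ +-assoc (choose p (suc q + j)) (rowSum (suc p) (suc q) j) _ ⟨
    rowSum p (suc q) (suc j) + choose (suc p + j) q
      ≡⟨ cong (λ k → rowSum p (suc q) (suc j) + choose k q) (+-suc p j) ⟨
    rowSum p (suc q) (suc j) + choose (p + suc j) q ∎

  rowSum-pascal : ∀ p q j → rowSum (suc p) (suc q) j ≡ rowSum p (suc q) j + rowSum (suc p) q j
  rowSum-pascal p q zero    = refl
  rowSum-pascal p q (suc j) = trans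
    (cong (choose p (suc q + j) + choose (suc p) (q + j) +_) (rowSum-pascal (suc p) q j))
    (interchange +-commutativeSemigroup (choose p (suc q + j)) (choose (suc p) (q + j)) _ _)

  -- The recursion of `walks`. By Pascal, a window of j+1 coefficients is the sum of two windows of
  -- j+1 in the previous row, shifted by one; their union has j+2 entries and their intersection has
  -- j.
  rowSum-walk : ∀ p q j → rowSum (suc p) (suc q) (suc j) ≡ rowSum p q (2 + j) + rowSum (suc p) (suc q) j
  rowSum-walk p q j = begin-equality
    rowSum (suc p) (suc q) (suc j)
      ≡⟨ rowSum-pascal p q (suc j) ⟩
    (choose p (suc q + j) + rowSum (suc p) (suc q) j) + rowSum (suc p) q (suc j)
      ≡⟨ cong (λ k → choose p k + rowSum (suc p) (suc q) j + rowSum (suc p) q (suc j)) (+-suc q j) ⟨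
    (choose p (q + suc j) + rowSum (suc p) (suc q) j) + rowSum (suc p) q (suc j)
      ≡⟨ swap (choose p (q + suc j)) (rowSum (suc p) (suc q) j) _ ⟩
    rowSum p q (2 + j) + rowSum (suc p) (suc q) j ∎
    where
    swap : ∀ a b c → a + b + c ≡ a + c + b
    swap = solve-∀

  -- The inner entries of row j+1 split by Pascal into row j without its last entry and row j
  -- without its first; the two ends of row j+1 supply the missing ones.
  rowSum-full : ∀ j → rowSum 0 0 (suc j) ≡ 2 ^ j
  rowSum-full zero    = refl
  rowSum-full (suc j) = suc-injective (begin-equality
    suc (rowSum 0 0 (2 + j))
      ≡⟨ cong (2 +_) (trans (rowSum-snoc 1 0 j) (trans (cong (rowSum 1 1 j +_) (choose-zeroʳ (1 + j))) (+-comm _ 1))) ⟩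
    3 + rowSum 1 1 j
      ≡⟨ cong (3 +_) (rowSum-pascal 0 0 j) ⟩
    3 + (rowSum 0 1 j + rowSum 1 0 j)
      ≡⟨ regroup (rowSum 0 1 j) (rowSum 1 0 j) ⟩
    suc ((rowSum 0 1 j + 1) + (1 + rowSum 1 0 j))
      ≡⟨ cong suc (cong₂ _+_ first (rowSum-full j)) ⟩
    suc (2 ^ j + 2 ^ j)
      ≡⟨ cong (λ x → suc (2 ^ j + x)) (+-identityʳ (2 ^ j)) ⟨
    suc (2 * 2 ^ j) ∎)
    where
    regroup : ∀ a b → 3 + (a + b) ≡ suc ((a + 1) + (1 + b))
    regroup = solve-∀
    first : rowSum 0 1 j + 1 ≡ 2 ^ j
    first = trans (cong (rowSum 0 1 j +_) (sym (choose-zeroʳ j))) (trans (sym (rowSum-snoc 0 0 j)) (rowSum-full j))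

  -- The reflection principle as an inequality: both sides obey the same recursion, and at r = 0 the
  -- window is the full row, with sum 2^j.
  walks≤rowSum : ∀ r j → walks (2 * r + j) (suc j) ≤ rowSum r r (suc j)
  walks≤rowSum zero    j = ≤-trans (walks≤2^ j (suc j)) (≤-reflexive (sym (rowSum-full j)))
  walks≤rowSum (suc r) zero = begin
    walks (2 * suc r + 0) 1                              ≡⟨ cong (λ m → walks m 1) (shift r 0) ⟩
    walks (2 * r + 1) 2 + 0                              ≤⟨ +-monoˡ-≤ 0 (walks≤rowSum r 1) ⟩
    rowSum r r 2 + 0                                     ≡⟨ rowSum-walk r r 0 ⟨
    rowSum (suc r) (suc r) 1                             ∎
    where
    shift : ∀ r j → 2 * suc r + j ≡ suc (2 * r + suc j)
    shift = solve-∀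
  walks≤rowSum (suc r) (suc j) = begin
    walks (2 * suc r + suc j) (2 + j)
      ≡⟨ cong (λ m → walks m (2 + j)) (+-suc (2 * suc r) j) ⟩
    walks (2 * suc r + j) (3 + j) + walks (2 * suc r + j) (suc j)
      ≡⟨ cong (λ m → walks m (3 + j) + walks (2 * suc r + j) (suc j)) (shift r j) ⟩
    walks (2 * r + (2 + j)) (3 + j) + walks (2 * suc r + j) (suc j)
      ≤⟨ +-mono-≤ (walks≤rowSum r (2 + j)) (walks≤rowSum (suc r) j) ⟩
    rowSum r r (3 + j) + rowSum (suc r) (suc r) (suc j)
      ≡⟨ rowSum-walk r r (suc j) ⟨
    rowSum (suc r) (suc r) (2 + j) ∎
    where
    shift : ∀ r j → 2 * suc r + j ≡ 2 * r + (2 + j)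
    shift = solve-∀

  walks≤centralChoose : ∀ r → walks (2 * r) 1 ≤ choose r r
  walks≤centralChoose r = begin
    walks (2 * r) 1           ≡⟨ cong (λ m → walks m 1) (+-identityʳ (2 * r)) ⟨
    walks (2 * r + 0) 1       ≤⟨ walks≤rowSum r 0 ⟩
    choose r (r + 0) + 0      ≡⟨ trans (+-identityʳ _) (cong (choose r) (+-identityʳ r)) ⟩
    choose r r                ∎

-- Finite sums, indicator counts, averaging and enumeration of decidable subsets.

module Counting where

  open import Algebra.Properties.CommutativeSemigroup using (interchange)
  import Algebra.Properties.Semiring.Sum as SemiringSum
  open import Data.Fin.Properties using (suc-injective)
  open import Data.List.Base using (List; []; _∷_; map; length; _++_; cartesianProductWith)
  open import Data.List.Membership.Propositional using (_∈_)
  open import Data.List.Membership.Propositional.Properties using (∈-cartesianProductWith⁺)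
  import Data.List.Properties as List
  open import Data.List.Relation.Unary.Any using (here; there)
  open import Data.Nat.Base
  open import Data.Nat.ListAction using (sum)
  open import Data.Nat.ListAction.Properties using (sum-++)
  open import Data.Nat.Properties hiding (suc-injective)
  open import Data.Vec.Base as Vec using (Vec)
  open import Relation.Binary.PropositionalEquality
    using (_≡_; refl; sym; trans; cong; cong₂)

  open ≤-Reasoning
  module ℕΣ = SemiringSum +-*-semiring
  module ℝΣ = SemiringSum (CommutativeRing.semiring RealLemmas.ℝ-commutativeRing)

  module _ {A : Set} where

    ∑ₗ : List A → (A → ℕ) → ℕ
    ∑ₗ xs f = sum (map f xs)

    ∑ₗ-mono : ∀ xs {f g} → (∀ x → f x ≤ g x) → ∑ₗ xs f ≤ ∑ₗ xs g
    ∑ₗ-mono []       f≤g = z≤n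
    ∑ₗ-mono (x ∷ xs) f≤g = +-mono-≤ (f≤g x) (∑ₗ-mono xs f≤g)

    ∑ₗ-+ : ∀ xs f g → ∑ₗ xs (λ x → f x + g x) ≡ ∑ₗ xs f + ∑ₗ xs g
    ∑ₗ-+ []       f g = refl
    ∑ₗ-+ (x ∷ xs) f g = trans (cong (f x + g x +_) (∑ₗ-+ xs f g)) (interchange +-commutativeSemigroup (f x) (g x) _ _)

    ∑ₗ-upper : ∀ xs {f c} → (∀ {x} → x ∈ xs → f x ≤ c) → ∑ₗ xs f ≤ length xs * c
    ∑ₗ-upper []       f≤c = z≤n
    ∑ₗ-upper (x ∷ xs) f≤c = +-mono-≤ (f≤c (here refl)) (∑ₗ-upper xs (f≤c ∘ there))

    ∈⇒≤∑ₗ : ∀ {x xs} f → x ∈ xs → f x ≤ ∑ₗ xs f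
    ∈⇒≤∑ₗ {xs = _ ∷ xs} f (here refl)    = m≤m+n _ (∑ₗ xs f)
    ∈⇒≤∑ₗ {xs = y ∷ xs} f (there x∈xs) = ≤-trans (∈⇒≤∑ₗ f x∈xs) (m≤n+m _ (f y))

    ∑ₗ-∑ : ∀ {n} xs (f : A → Fin n → ℕ) →
           ∑ₗ xs (λ x → ℕΣ.sum (f x)) ≡ ℕΣ.sum (λ i → ∑ₗ xs (λ x → f x i))
    ∑ₗ-∑ {n} []       f = sym (ℕΣ.sum-replicate-zero n)
    ∑ₗ-∑     (x ∷ xs) f = trans (cong (ℕΣ.sum (f x) +_) (∑ₗ-∑ xs f)) (sym (ℕΣ.∑-distrib-+ (f x) _))

    below-average : ∀ xs {f b} → ∑ₗ xs f < length xs * b → ∃ λ x → f x < b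
    below-average (x ∷ xs) {f} {b} avg with f x <? b
    ... | yes fx<b = x , fx<b
    ... | no  fx≮b = below-average xs (+-cancelˡ-< b _ _ (≤-<-trans (+-monoˡ-≤ (∑ₗ xs f) (≮⇒≥ fx≮b)) avg))

  ∑ₗ-product : ∀ {A B C : Set} (g : A → B → C) xs ys f →
               ∑ₗ (cartesianProductWith g xs ys) f ≡ ∑ₗ xs (λ x → ∑ₗ ys (λ y → f (g x y)))
  ∑ₗ-product g []       ys f = refl
  ∑ₗ-product g (x ∷ xs) ys f = begin-equality
    sum (map f (map (g x) ys ++ rest))               ≡⟨ cong sum (List.map-++ f (map (g x) ys) rest) ⟩
    sum (map f (map (g x) ys) ++ map f rest)         ≡⟨ sum-++ (map f (map (g x) ys)) (map f rest) ⟩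
    sum (map f (map (g x) ys)) + sum (map f rest)    ≡⟨ cong₂ _+_ (cong sum (sym (List.map-∘ ys))) (∑ₗ-product g xs ys f) ⟩
    ∑ₗ (x ∷ xs) (λ x → ∑ₗ ys (λ y → f (g x y)))      ∎
    where rest = cartesianProductWith g xs ys

  length-product : ∀ {A B C : Set} (g : A → B → C) xs ys →
                   length (cartesianProductWith g xs ys) ≡ length xs * length ys
  length-product g []       ys = refl
  length-product g (x ∷ xs) ys = trans (List.length-++ (map (g x) ys))
    (cong₂ _+_ (List.length-map (g x) ys) (length-product g xs ys))

  module _ {A : Set} (xs : List A) where

    -- Lists the sign vectors, and by being applied twice also the 0/1 matrices as words of rows.
    words : ∀ n → List (Vec A n)
    words zero    = Vec.[] ∷ []
    words (suc n) = cartesianProductWith Vec._∷_ xs (words n)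

    length-words : ∀ n → length (words n) ≡ length xs ^ n
    length-words zero    = refl
    length-words (suc n) = trans (length-product Vec._∷_ xs (words n))
      (cong (length xs *_) (length-words n))

    ∈-words : (∀ x → x ∈ xs) → ∀ {n} (v : Vec A n) → v ∈ words n
    ∈-words all Vec.[]      = here refl
    ∈-words all (x Vec.∷ v) = ∈-cartesianProductWith⁺ Vec._∷_ (all x) (∈-words all v)

  bit : ∀ {P : Set} → Dec P → ℕ
  bit (yes _) = 1
  bit (no  _) = 0

  bit-mono : ∀ {P Q : Set} (P? : Dec P) (Q? : Dec Q) → (P → Q) → bit P? ≤ bit Q?
  bit-mono (yes p) (yes _) P⇒Q = ≤-refl
  bit-mono (yes p) (no ¬q) P⇒Q = contradiction (P⇒Q p) ¬q
  bit-mono (no  _) Q?      P⇒Q = z≤n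

  bit-true : ∀ {P : Set} (P? : Dec P) → P → bit P? ≡ 1
  bit-true (yes _) p = refl
  bit-true (no ¬p) p = contradiction p ¬p

  bit-false : ∀ {P : Set} (P? : Dec P) → ¬ P → bit P? ≡ 0
  bit-false (yes p) ¬p = contradiction p ¬p
  bit-false (no  _) ¬p = refl

  bit-⊎ : ∀ {P Q R : Set} (P? : Dec P) (Q? : Dec Q) (R? : Dec R) → (P → Q ⊎ R) → bit P? ≤ bit Q? + bit R?
  bit-⊎ (no  _) Q? R? P⇒Q⊎R = z≤n
  bit-⊎ (yes p) Q? R? P⇒Q⊎R with P⇒Q⊎R p
  ... | inj₁ q = ≤-trans (≤-reflexive (sym (bit-true Q? q))) (m≤m+n _ (bit R?))
  ... | inj₂ r = ≤-trans (≤-reflexive (sym (bit-true R? r))) (m≤n+m _ (bit Q?))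

  ∑-mono : ∀ {n} {f g : Fin n → ℕ} → (∀ i → f i ≤ g i) → ℕΣ.sum f ≤ ℕΣ.sum g
  ∑-mono {zero}  f≤g = z≤n
  ∑-mono {suc n} f≤g = +-mono-≤ (f≤g zero) (∑-mono (f≤g ∘ suc))

  ∑-upper : ∀ {n} {f : Fin n → ℕ} {c} → (∀ i → f i ≤ c) → ℕΣ.sum f ≤ n * c
  ∑-upper {zero}  f≤c = z≤n
  ∑-upper {suc n} f≤c = +-mono-≤ (f≤c zero) (∑-upper (f≤c ∘ suc))

  count : ∀ {n} {P : Fin n → Set} → (∀ i → Dec (P i)) → ℕ
  count P? = ℕΣ.sum (λ i → bit (P? i))

  -- The deciders are separate arguments because excluded middle is invoked separately for `P i` and
  -- for `¬ P i`.
  count-¬ : ∀ {n} {P : Fin n → Set} (P? : ∀ i → Dec (P i)) (¬P? : ∀ i → Dec (¬ P i)) →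
            n ≡ count P? + count ¬P?
  count-¬ {zero}  P? ¬P? = refl
  count-¬ {suc n} P? ¬P? = trans (cong₂ _+_ (one (P? zero) (¬P? zero)) (count-¬ (P? ∘ suc) (¬P? ∘ suc)))
    (interchange +-commutativeSemigroup (bit (P? zero)) (bit (¬P? zero)) _ _)
    where
    one : ∀ {Q : Set} (Q? : Dec Q) (¬Q? : Dec (¬ Q)) → 1 ≡ bit Q? + bit ¬Q?
    one (yes q) ¬Q? = cong suc (sym (bit-false ¬Q? λ ¬q → ¬q q))
    one (no ¬q) ¬Q? = sym (bit-true ¬Q? ¬q)

  -- Turns a count into an indexing. It selects eigenvalues from a longer list, and for the support
  -- of an eigenvector `∑-element` carries the eigenvalue equation over to the induced subgraph.
  record Enumeration {n} (P : Fin n → Set) (k : ℕ) : Set where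
    field
      element   : Fin k → Fin n
      injective : ∀ {a b} → element a ≡ element b → a ≡ b
      sound     : ∀ a → P (element a)
      complete  : ∀ {i} → P i → ∃ λ a → element a ≡ i
      ∑-element : ∀ (f : Fin n → ℝ) → (∀ i → ¬ P i → f i ≈ℝ 0ℝ) → ∑ f ≈ℝ ∑ (f ∘ element)

  enumeration : ∀ {n} {P : Fin n → Set} (P? : ∀ i → Dec (P i)) → Enumeration P (count P?)
  enumeration {zero}  P? = record
    { element = λ () ; injective = λ {} ; sound = λ () ; complete = λ {}
    ; ∑-element = λ f _ → RealLemmas.≈-refl }
  enumeration {suc n} {P} P? with P? zero | enumeration (P? ∘ suc)
  ... | yes p₀ | E = record
    { element   = elem
    ; injective = inj
    ; sound     = λ where zero → p₀ ; (suc a) → E.sound a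
    ; complete  = comp
    ; ∑-element = λ f f≈0 → RealLemmas.+-cong RealLemmas.≈-refl (E.∑-element (f ∘ suc) (f≈0 ∘ suc))
    }
    where
    module E = Enumeration E
    elem : Fin (suc (count (P? ∘ suc))) → Fin (suc n)
    elem zero    = zero
    elem (suc a) = suc (E.element a)
    inj : ∀ {a b} → elem a ≡ elem b → a ≡ b
    inj {zero}  {zero}  eq = refl
    inj {suc a} {suc b} eq = cong suc (E.injective (suc-injective eq))
    comp : ∀ {i} → P i → ∃ λ a → elem a ≡ i
    comp {zero}  p = zero , refl
    comp {suc i} p = let a , eq = E.complete p in suc a , cong suc eq
  ... | no ¬p₀ | E = record
    { element   = suc ∘ E.element
    ; injective = λ eq → E.injective (suc-injective eq)
    ; sound     = E.sound
    ; complete  = comp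
    ; ∑-element = λ f f≈0 → RealLemmas.≈-trans
        (RealLemmas.+-cong (f≈0 zero ¬p₀) (E.∑-element (f ∘ suc) (f≈0 ∘ suc)))
        (RealLemmas.+-identityˡ _)
    }
    where
    module E = Enumeration E
    comp : ∀ {i} → P i → ∃ λ a → suc (E.element a) ≡ i
    comp {zero}  p = contradiction p ¬p₀
    comp {suc i} p = let a , eq = E.complete p in a , cong suc eq

-- The Littlewood-Offord inequality for real entries and several targets.

module LittlewoodOfford (em : ExcludedMiddle 0ℓ) where

  open import Data.List.Base using (List; []; _∷_; map; length)
  import Data.List.Properties as List
  open import Data.List.Relation.Unary.All as All using (All; []; _∷_)
  import Data.List.Relation.Unary.All.Properties as All
  open import Data.List.Relation.Unary.AllPairs using (AllPairs; []; _∷_)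
  open import Data.Nat.Base
  open import Data.Nat.ListAction using (sum)
  open import Data.Nat.Properties
  open import Data.Nat.Tactic.RingSolver using (solve-∀)
  open import Data.Sign.Base as Sign using (Sign)
  open import Data.Vec.Base as Vec using (Vec)
  open import Relation.Binary.PropositionalEquality
    using (_≡_; refl; sym; trans; cong; cong₂)

  open RealLemmas using (≈-refl; ≈-sym; ≈-trans; <ℝ-irrefl; <ℝ-trans; +-monoˡ-<ℝ; trichotomy;
    0<x⇒t-x<t+x; x<0⇒t+x<t-x; ℝ-commutativeRing)
  open Counting
  open Binomials

  Decreasing : List ℝ → Set
  Decreasing = AllPairs (λ t u → u <ℝ t)

  Increasing-map : (ℝ → ℝ) → Set
  Increasing-map φ = ∀ {t u} → t <ℝ u → φ t <ℝ φ u

  decreasing-map : ∀ {φ T} → Increasing-map φ → Decreasing T → Decreasing (map φ T)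
  decreasing-map φ-mono []          = []
  decreasing-map φ-mono (t> ∷ decr) = All.map⁺ (All.map φ-mono t>) ∷ decreasing-map φ-mono decr

  -- The induction hypothesis, cross-multiplied. Here `g t` will count the sign vectors of length n
  -- with signed sum t, `k` entries are known to be nonzero, and a decreasing list encodes a finite
  -- set of targets.
  record Bound (n k : ℕ) (g : ℝ → ℕ) : Set where
    constructor mkBound
    field
      at : ∀ T → Decreasing T → ∑ₗ T g * 2 ^ k ≤ 2 ^ n * walks k (length T)

  open Bound

  module _ {n k : ℕ} {g : ℝ → ℕ} (bound : Bound n k g)
    {lo hi : ℝ → ℝ} (lo-mono : Increasing-map lo) (hi-mono : Increasing-map hi) where

    ∑-shifts : ∀ T → ∑ₗ T (λ t → g (lo t) + g (hi t)) ≡ ∑ₗ (map lo T) g + ∑ₗ (map hi T) g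
    ∑-shifts T = trans (∑ₗ-+ T (g ∘ lo) (g ∘ hi))
      (cong₂ (λ us vs → sum us + sum vs) (List.map-∘ T) (List.map-∘ T))

    -- `lo` and `hi` will shift a target by an entry, down and up. Bounding the two shifted lists
    -- separately gains nothing over doubling, which is enough for an entry not counted in `k`.
    bound-skip : Bound (suc n) k (λ t → g (lo t) + g (hi t))
    bound-skip = mkBound λ T decr → begin
      ∑ₗ T (λ t → g (lo t) + g (hi t)) * 2 ^ k
        ≡⟨ cong (_* 2 ^ k) (∑-shifts T) ⟩
      (∑ₗ (map lo T) g + ∑ₗ (map hi T) g) * 2 ^ k
        ≡⟨ *-distribʳ-+ (2 ^ k) (∑ₗ (map lo T) g) (∑ₗ (map hi T) g) ⟩
      ∑ₗ (map lo T) g * 2 ^ k + ∑ₗ (map hi T) g * 2 ^ k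
        ≤⟨ +-mono-≤ (at bound (map lo T) (decreasing-map lo-mono decr)) (at bound (map hi T) (decreasing-map hi-mono decr)) ⟩
      2 ^ n * walks k (length (map lo T)) + 2 ^ n * walks k (length (map hi T))
        ≡⟨ cong₂ (λ i j → 2 ^ n * walks k i + 2 ^ n * walks k j) (List.length-map lo T) (List.length-map hi T) ⟩
      2 ^ n * walks k (length T) + 2 ^ n * walks k (length T)
        ≡⟨ double (2 ^ n) (walks k (length T)) ⟩
      2 ^ suc n * walks k (length T) ∎
      where
      open ≤-Reasoning
      double : ∀ a b → a * b + a * b ≡ 2 * a * b
      double = solve-∀

    -- The largest of the upper shifts exceeds all lower shifts, so moving it to the
    -- lower ones leaves two decreasing lists, one longer and one shorter than T.
    bound-step : (∀ t → lo t <ℝ hi t) → Bound (suc n) (suc k) (λ t → g (lo t) + g (hi t))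
    bound-step lo<hi = mkBound step
      where
      open ≤-Reasoning
      regroup : ∀ a b c x → (a + (b + c)) * (2 * x) ≡ 2 * ((b + a) * x + c * x)
      regroup = solve-∀
      collect : ∀ a b c → 2 * (a * b + a * c) ≡ 2 * a * (b + c)
      collect = solve-∀

      step : ∀ T → Decreasing T →
             ∑ₗ T (λ t → g (lo t) + g (hi t)) * 2 ^ suc k ≤ 2 ^ suc n * walks (suc k) (length T)
      step []       []          = z≤n
      step (t ∷ ts) (t> ∷ decr) = begin
        ∑ₗ (t ∷ ts) (λ t → g (lo t) + g (hi t)) * 2 ^ suc k
          ≡⟨ cong (_* 2 ^ suc k) (∑-shifts (t ∷ ts)) ⟩
        (∑ₗ (map lo (t ∷ ts)) g + (g (hi t) + ∑ₗ (map hi ts) g)) * 2 ^ suc k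
          ≡⟨ regroup (∑ₗ (map lo (t ∷ ts)) g) (g (hi t)) (∑ₗ (map hi ts) g) (2 ^ k) ⟩
        2 * (∑ₗ (hi t ∷ map lo (t ∷ ts)) g * 2 ^ k + ∑ₗ (map hi ts) g * 2 ^ k)
          ≤⟨ *-monoʳ-≤ 2 (+-mono-≤
               (at bound (hi t ∷ map lo (t ∷ ts))
                 ((lo<hi t ∷ All.map⁺ (All.map (λ u<t → <ℝ-trans (lo-mono u<t) (lo<hi t)) t>))
                   ∷ decreasing-map lo-mono (t> ∷ decr)))
               (at bound (map hi ts) (decreasing-map hi-mono decr))) ⟩
        -- The two list lengths are exactly the neighbours of `length T` in the recursion of
        -- `walks`.
        2 * (2 ^ n * walks k (2 + length (map lo ts)) + 2 ^ n * walks k (length (map hi ts)))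
          ≡⟨ cong₂ (λ i j → 2 * (2 ^ n * walks k (2 + i) + 2 ^ n * walks k j)) (List.length-map lo ts) (List.length-map hi ts) ⟩
        2 * (2 ^ n * walks k (2 + length ts) + 2 ^ n * walks k (length ts))
          ≡⟨ collect (2 ^ n) (walks k (2 + length ts)) (walks k (length ts)) ⟩
        2 ^ suc n * walks (suc k) (suc (length ts)) ∎

  bound-mono : ∀ {n k g h} → (∀ t → h t ≤ g t) → Bound n k g → Bound n k h
  bound-mono {k = k} h≤g bound = mkBound λ T decr →
    ≤-trans (*-monoˡ-≤ (2 ^ k) (∑ₗ-mono T h≤g)) (at bound T decr)

  signs : List Sign
  signs = Sign.+ ∷ Sign.- ∷ []

  dot : ∀ {n} → Vec Sign n → Vector ℝ n → ℝ
  dot s x = signVector (Vec.lookup s) · x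

  hits : ∀ {n} → Vector ℝ n → ℝ → ℕ
  hits {n} x t = ∑ₗ (words signs n) (λ s → bit (em {dot s x ≈ℝ t}))

  support : ∀ {n} → Vector ℝ n → ℕ
  support x = count (λ i → em {¬ x i ≈ℝ 0ℝ})

  module _ where

    module R = CommutativeRing ℝ-commutativeRing
    open import Algebra.Properties.Ring R.ring using (-1*x≈-x; -‿involutive)
    import Relation.Binary.Reasoning.Setoid R.setoid as ≈-Reasoning

    signValue : Sign → ℝ
    signValue Sign.+ = 1ℝ
    signValue Sign.- = -ℝ 1ℝ

    signVector≈ : ∀ {n} (s : Switching n) i → signVector s i ≈ℝ signValue (s i)
    signVector≈ s i with s i
    ... | Sign.+ = ≈-refl
    ... | Sign.- = ≈-refl

    dot-∷ : ∀ {n} σ (s : Vec Sign n) x → dot (σ Vec.∷ s) x ≈ℝ (signValue σ *ℝ x zero) +ℝ dot s (x ∘ suc)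
    dot-∷ σ s x = RealLemmas.+-cong (R.*-congʳ (signVector≈ (Vec.lookup (σ Vec.∷ s)) zero))
      (ℝΣ.sum-cong-≋ λ i → R.*-congʳ (≈-trans (signVector≈ (Vec.lookup (σ Vec.∷ s)) (suc i))
        (≈-sym (signVector≈ (Vec.lookup s) i))))

    move : ∀ a {b t} → a +ℝ b ≈ℝ t → b ≈ℝ t -ℝ a
    move a {b} {t} eq = begin
      b                      ≈⟨ R.+-identityˡ b ⟨
      0ℝ +ℝ b                ≈⟨ R.+-congʳ (R.-‿inverseˡ a) ⟨
      ((-ℝ a) +ℝ a) +ℝ b     ≈⟨ R.+-assoc (-ℝ a) a b ⟩
      (-ℝ a) +ℝ (a +ℝ b)     ≈⟨ R.+-comm (-ℝ a) (a +ℝ b) ⟩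
      (a +ℝ b) -ℝ a          ≈⟨ R.+-congʳ eq ⟩
      t -ℝ a                 ∎
      where open ≈-Reasoning

    hits-+ : ∀ {n} (s : Vec Sign n) x {t} → dot (Sign.+ Vec.∷ s) x ≈ℝ t → dot s (x ∘ suc) ≈ℝ t -ℝ x zero
    hits-+ s x eq = ≈-trans (move _ (≈-trans (≈-sym (dot-∷ Sign.+ s x)) eq))
      (R.+-congˡ (R.-‿cong (R.*-identityˡ (x zero))))

    hits-- : ∀ {n} (s : Vec Sign n) x {t} → dot (Sign.- Vec.∷ s) x ≈ℝ t → dot s (x ∘ suc) ≈ℝ t +ℝ x zero
    hits-- s x eq = ≈-trans (move _ (≈-trans (≈-sym (dot-∷ Sign.- s x)) eq))
      (R.+-congˡ (≈-trans (R.-‿cong (-1*x≈-x (x zero))) (-‿involutive (x zero))))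

  -- Splits on the first sign, which moves the target by the first entry in the opposite direction.
  hits-∷ : ∀ {n} (x : Vector ℝ (suc n)) t →
           hits x t ≤ hits (x ∘ suc) (t -ℝ x zero) + hits (x ∘ suc) (t +ℝ x zero)
  hits-∷ {n} x t = begin
    hits x t
      ≡⟨ ∑ₗ-product Vec._∷_ signs (words signs n) (λ s → bit (em {dot s x ≈ℝ t})) ⟩
    ∑ₗ (words signs n) (λ s → bit (em {dot (Sign.+ Vec.∷ s) x ≈ℝ t}))
      + (∑ₗ (words signs n) (λ s → bit (em {dot (Sign.- Vec.∷ s) x ≈ℝ t})) + 0)
      ≤⟨ +-mono-≤ (∑ₗ-mono (words signs n) λ s → bit-mono em em (hits-+ s x))
           (≤-trans (≤-reflexive (+-identityʳ _))
             (∑ₗ-mono (words signs n) λ s → bit-mono em em (hits-- s x))) ⟩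
    hits (x ∘ suc) (t -ℝ x zero) + hits (x ∘ suc) (t +ℝ x zero) ∎
    where open ≤-Reasoning

  -- The only signed sum is the empty one, and 0 occurs at most once in a strictly decreasing list.
  hits-[] : ∀ (x : Vector ℝ 0) → Bound 0 0 (hits x)
  hits-[] x = mkBound λ T decr → ≤-trans (≤-reflexive (*-identityʳ (∑ₗ T (hits x))))
    (≤-trans (atMostOne T decr) (≤-reflexive (sym (+-identityʳ (walks 0 (length T))))))
    where
    none : ∀ {t} T → 0ℝ ≈ℝ t → All (_<ℝ t) T → ∑ₗ T (hits x) ≡ 0
    none []      0≈t []         = refl
    none (u ∷ T) 0≈t (u<t ∷ T<) = cong₂ (λ m n → m + 0 + n)
      (bit-false em λ 0≈u → <ℝ-irrefl (≈-trans (≈-sym 0≈u) 0≈t) u<t) (none T 0≈t T<)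

    atMostOne : ∀ T → Decreasing T → ∑ₗ T (hits x) ≤ walks 0 (length T)
    atMostOne []      []          = z≤n
    atMostOne (t ∷ T) (t> ∷ decr) with em {0ℝ ≈ℝ t}
    ... | yes 0≈t = ≤-reflexive (cong suc (none T 0≈t t>))
    ... | no  _   = ≤-trans (atMostOne T decr) (walks≤2^ 0 (length T))

  -- Induction on the entries: `bound-skip` for a zero entry, `bound-step` for a nonzero one, its
  -- sign deciding which shift is the lower. Asking only for k ≤ `support x` lets the proof use an
  -- even number of nonzero entries.
  littlewoodOfford : ∀ {n} (x : Vector ℝ n) k → k ≤ support x → Bound n k (hits x)
  littlewoodOfford {zero}  x .zero z≤n = hits-[] x
  littlewoodOfford {suc n} x k     k≤ with em {¬ x zero ≈ℝ 0ℝ}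
  ... | no  _   = bound-mono (hits-∷ x) (bound-skip (littlewoodOfford (x ∘ suc) k k≤)
    (+-monoˡ-<ℝ (-ℝ x zero)) (+-monoˡ-<ℝ (x zero)))
  -- All k entries are already accounted for, so a further nonzero entry is skipped.
  littlewoodOfford {suc n} x zero _ | yes _ = bound-mono (hits-∷ x)
    (bound-skip (littlewoodOfford (x ∘ suc) zero z≤n) (+-monoˡ-<ℝ (-ℝ x zero)) (+-monoˡ-<ℝ (x zero)))
  littlewoodOfford {suc n} x (suc k) (s≤s k≤) | yes x≉0 with trichotomy em (x zero)
  ... | inj₂ (inj₁ x≈0) = contradiction x≈0 x≉0
  ... | inj₂ (inj₂ 0<x) = bound-mono (hits-∷ x)
    (bound-step (littlewoodOfford (x ∘ suc) k k≤) (+-monoˡ-<ℝ (-ℝ x zero)) (+-monoˡ-<ℝ (x zero))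
      (λ t → 0<x⇒t-x<t+x t 0<x))
  -- For a negative entry t + x is the lower shift, so the summands of `hits-∷` change places.
  ... | inj₁ x<0        = bound-mono
    (λ t → ≤-trans (hits-∷ x t) (≤-reflexive (+-comm (hits (x ∘ suc) (t -ℝ x zero)) _)))
    (bound-step (littlewoodOfford (x ∘ suc) k k≤) (+-monoˡ-<ℝ (x zero)) (+-monoˡ-<ℝ (-ℝ x zero))
      (λ t → x<0⇒t+x<t-x t x<0))

  hits-0 : ∀ {n} (x : Vector ℝ n) r → 2 * r ≤ support x → hits x 0ℝ * 4 ^ r ≤ 2 ^ n * choose r r
  hits-0 {n} x r 2r≤ = begin
    hits x 0ℝ * 4 ^ r                  ≡⟨ cong₂ _*_ (sym (+-identityʳ (hits x 0ℝ))) (^-*-assoc 2 2 r) ⟩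
    (hits x 0ℝ + 0) * 2 ^ (2 * r)      ≤⟨ at (littlewoodOfford x (2 * r) 2r≤) (0ℝ ∷ []) ([] ∷ []) ⟩
    2 ^ n * walks (2 * r) 1            ≤⟨ *-monoʳ-≤ (2 ^ n) (walks≤centralChoose r) ⟩
    2 ^ n * choose r r                 ∎
    where open ≤-Reasoning

-- From inequalities in ℕ to the real estimate with (log d)^(1/4).

module LogarithmBound where

  import Data.Integer.Base as ℤ
  open import Data.Nat.Base as ℕ using (ℕ; zero; suc)
  import Data.Nat.Properties as ℕ
  open import Data.Rational.Base using (ℚ; 0ℚ; 1ℚ; _/_; _+_; _*_; _-_; -_; _≤_; _<_)
  import Data.Rational.Properties as ℚ
  open import Data.Rational.Solver using (module +-*-Solver)
  open import Relation.Binary.PropositionalEquality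
    using (_≡_; refl; sym; trans; cong; cong₂; subst)

  open ℚ-Lemmas
  open Root-Lemmas
  open +-*-Solver
  open ℚ.≤-Reasoning

  rsum-mono : ∀ {f k l} → (∀ j → 0ℚ ≤ f j) → k ℕ.≤ l → rsum f k ≤ rsum f l
  rsum-mono {f} {k} 0≤f k≤l = go (ℕ.≤⇒≤′ k≤l)
    where
    go : ∀ {l} → k ℕ.≤′ l → rsum f k ≤ rsum f l
    go ℕ.≤′-refl               = ℚ.≤-refl
    go (ℕ.≤′-step {l} k≤l) = ℚ.≤-trans (go k≤l) (p≤p+q (rsum f l) (0≤f l))

  ι-suc : ∀ k → ι (suc k) ≡ ι k + 1ℚ
  ι-suc k = trans (cong ι (ℕ.+-comm 1 k)) (ι-+ k 1)

  module _ (m : ℕ) where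

    private
      f : ℕ → ℚ
      f j = ℤ.+ 1 / (suc m ℕ.+ suc j)

    -- Each of the K dyadic blocks of [1, 2^K] contributes at most 1.
    dyadic-bound : ∀ K → ∃ λ e → 2 ℕ.^ K ≡ suc e × rsum f (e ℕ.* suc m) ≤ ι K
    dyadic-bound zero    = 0 , refl , ℚ.≤-refl
    dyadic-bound (suc K) with dyadic-bound K
    ... | e , 2^K≡ , ih = e ℕ.+ suc e , eq , (begin
      rsum f ((e ℕ.+ suc e) ℕ.* suc m)
        ≡⟨ cong (rsum f) (ℕ.*-distribʳ-+ (suc m) e (suc e)) ⟩
      rsum f (e ℕ.* suc m ℕ.+ suc e ℕ.* suc m)
        ≡⟨ rsum-split f (e ℕ.* suc m) (suc e ℕ.* suc m) ⟩
      rsum f (e ℕ.* suc m) + rsum g (suc e ℕ.* suc m)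
        -- With N = suc m, the new block has 2^K·N terms, each at most 1/(2^K·N).
        ≤⟨ ℚ.+-mono-≤ ih (rsum-upper g (suc e ℕ.* suc m) (1/suc (m ℕ.+ e ℕ.* suc m)) λ j _ →
             1/suc-anti (ℕ.+-monoʳ-≤ m (ℕ.m≤n⇒m≤1+n (ℕ.m≤m+n (e ℕ.* suc m) j)))) ⟩
      ι K + ι (suc e ℕ.* suc m) * 1/suc (m ℕ.+ e ℕ.* suc m)
        ≡⟨ cong (ι K +_) (ι-suc*1/suc (m ℕ.+ e ℕ.* suc m)) ⟩
      ι K + 1ℚ
        ≡⟨ ι-suc K ⟨
      ι (suc K) ∎)
      where
      g : ℕ → ℚ
      g j = f (e ℕ.* suc m ℕ.+ j)
      eq : 2 ℕ.^ suc K ≡ suc (e ℕ.+ suc e)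
      eq = trans (cong (λ x → 2 ℕ.* x) 2^K≡) (cong (λ x → suc e ℕ.+ x) (ℕ.+-identityʳ (suc e)))

    -- The bound log d ≤ log₂ d, made at every mesh instead of in the limit.
    riemannSum≤ : ∀ d K → d ℕ.≤ 2 ℕ.^ K → riemannSum d m ≤ ι K
    riemannSum≤ d K d≤2^K with dyadic-bound K
    ... | e , 2^K≡ , bound = ℚ.≤-trans
      (rsum-mono {f} (λ j → ℚ.<⇒≤ (0<1/suc (m ℕ.+ suc j)))
        (ℕ.*-monoˡ-≤ (suc m) (ℕ.≤-trans (ℕ.∸-monoˡ-≤ 1 d≤2^K) (ℕ.≤-reflexive (cong (ℕ._∸ 1) 2^K≡)))))
      bound

  -- An approximation r > b would satisfy r⁴ ≥ b⁴ + (r - b)⁴ > b⁴ ≥ q, against r⁴ ≤ q. Its default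
  -- value 0 is covered by 0 ≤ b.
  rootApprox≤ : ∀ q n b → 0ℚ ≤ b → q ≤ pow4 b → rootApprox q n ≤ b
  rootApprox≤ q n b 0≤b q≤b⁴ with <⊎≥ b (rootApprox q n) | rootApprox-lower q n
  ... | inj₂ r≤b | _          = r≤b
  ... | inj₁ b<r | inj₁ r≡0   = subst (_≤ b) (sym r≡0) 0≤b
  ... | inj₁ b<r | inj₂ r⁴≤q = contradiction (begin-strict
    pow4 b            <⟨ p<p+q (pow4 b) (0<pow4 0<r-b) ⟩
    pow4 b + pow4 δ   ≤⟨ pow4-super 0≤b (ℚ.<⇒≤ 0<r-b) ⟩
    pow4 (b + δ)      ≡⟨ cong pow4 (solve 2 (λ b r → b :+ (r :- b) := r) refl b (rootApprox q n)) ⟩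
    pow4 r            ≤⟨ r⁴≤q ⟩
    q                 ≤⟨ q≤b⁴ ⟩
    pow4 b            ∎) (ℚ.<-irrefl refl)
    where
    r = rootApprox q n
    δ = r - b
    0<r-b : 0ℚ < δ
    0<r-b = subst (_< δ) (ℚ.+-inverseʳ b) (ℚ.+-monoˡ-< (- b) b<r)

  -- `R` is a natural upper bound for (log d)^(1/4). Every approximation r of the root satisfies r ≤
  -- R, whence k ≤ C·d/R ≤ C·d/r once r is positive.
  log-estimate : ∀ {d M k} R C → (2≤d : 2 ℕ.≤ d) → d ≡ M ℕ.+ k → 1 ℕ.≤ R →
    d ℕ.≤ 2 ℕ.^ ((R ℕ.* R) ℕ.* (R ℕ.* R)) → k ℕ.* R ℕ.≤ C ℕ.* d →
    fromℕ d -ℝ fromℕ C *ℝ (fromℕ d ÷ℝ (log d) ^¼ [ 0<^¼ (log d) (0<log 2≤d) ]) ≤ℝ fromℕ M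
  -- From index `N` on the approximate roots are at least `δ`, so `recip` is a true inverse there.
  log-estimate {d} {M} {k} R C 2≤d d≡ 1≤R d≤ kR≤Cd = mk≤ λ ε 0<ε → N , λ n N≤n →
    ℚ.≤-trans (estimate (rootApprox (riemannSum d n) n)
      (ℚ.<-≤-trans (subst (0ℚ <_) (sym (ℚ.+-identityˡ δ)) 0<δ) (apart n N≤n))
      (rootApprox≤ (riemannSum d n) n (ι R) (0≤ι R) (ℚ.≤-trans (riemannSum≤ n d ((R ℕ.* R) ℕ.* (R ℕ.* R)) d≤) (ℚ.≤-reflexive ι-pow4))))
      (p≤p+q (ι M) (ℚ.<⇒≤ 0<ε))
    where
    open _<ℝ_ (0<^¼ (log d) (0<log 2≤d)) renaming (gap to δ; 0<gap to 0<δ; from to N)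

    ι-pow4 : ι ((R ℕ.* R) ℕ.* (R ℕ.* R)) ≡ pow4 (ι R)
    ι-pow4 = trans (ι-* (R ℕ.* R) (R ℕ.* R)) (cong₂ _*_ (ι-* R R) (ι-* R R))

    0<ιR : 0ℚ < ι R
    0<ιR = ℚ.<-≤-trans 0<1 (ι-mono-≤ 1≤R)

    estimate : ∀ r → 0ℚ < r → r ≤ ι R → ι d - ι C * (ι d * recip r) ≤ ι M
    estimate r 0<r r≤R = begin
      ι d - ι C * (ι d * recip r)      ≡⟨ cong (_- ι C * (ι d * recip r)) (trans (cong ι d≡) (ι-+ M k)) ⟩
      (ι M + ι k) - t                  ≤⟨ ℚ.+-monoˡ-≤ (- t) (ℚ.+-monoʳ-≤ (ι M) k≤t) ⟩
      (ι M + t) - t                    ≡⟨ solve 2 (λ a b → (a :+ b) :- b := a) refl (ι M) t ⟩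
      ι M                              ∎
      where
      t = ι C * (ι d * recip r)
      k≤t : ι k ≤ t
      k≤t = begin
        ι k                            ≡⟨ ℚ.*-identityʳ (ι k) ⟨
        ι k * 1ℚ                       ≡⟨ cong (ι k *_) (recip-inverse 0<ιR) ⟨
        ι k * (recip (ι R) * ι R)      ≡⟨ solve 3 (λ a b c → a :* (b :* c) := (a :* c) :* b) refl (ι k) (recip (ι R)) (ι R) ⟩
        (ι k * ι R) * recip (ι R)      ≡⟨ cong (_* recip (ι R)) (ι-* k R) ⟨
        ι (k ℕ.* R) * recip (ι R)      ≤⟨ *-mono-≤ (0≤ι (k ℕ.* R)) (ℚ.<⇒≤ (0<recip 0<r))
                                            (ι-mono-≤ kR≤Cd) (recip-anti 0<r r≤R) ⟩
        ι (C ℕ.* d) * recip r          ≡⟨ cong (_* recip r) (ι-* C d) ⟩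
        (ι C * ι d) * recip r          ≡⟨ ℚ.*-assoc (ι C) (ι d) (recip r) ⟩
        t                              ∎

-- Choice of the parameters and the arithmetic behind the constant 6.

module Parameters where

  open import Data.Nat.Base
  open import Data.Nat.Properties
  open import Data.Nat.Tactic.RingSolver using (solve-∀)
  open import Relation.Binary.PropositionalEquality
    using (_≡_; trans; cong)

  open ≤-Reasoning
  open Binomials using (choose; centralChoose-bound)

  n<2^n : ∀ n → n < 2 ^ n
  n<2^n zero    = s≤s z≤n
  n<2^n (suc n) = begin
    suc (suc n)       ≤⟨ +-mono-≤ (m^n>0 2 n) (n<2^n n) ⟩
    2 ^ n + 2 ^ n     ≡⟨ cong (2 ^ n +_) (+-identityʳ (2 ^ n)) ⟨
    2 * 2 ^ n         ∎

  n≤n*n : ∀ n → n ≤ n * n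
  n≤n*n zero      = z≤n
  n≤n*n n@(suc _) = m≤m*n n n

  square-cancel-≤ : ∀ {m n} → m * m ≤ n * n → m ≤ n
  square-cancel-≤ {m} {n} m²≤n² with m ≤? n
  ... | yes m≤n = m≤n
  ... | no  m≰n = contradiction m²≤n² (<⇒≱ (*-mono-< (≰⇒> m≰n) (≰⇒> m≰n)))

  crossing : ∀ {P : ℕ → Set} → (∀ k → Dec (P k)) → P 0 → ∀ b → ¬ P b → ∃ λ u → P u × ¬ P (suc u)
  crossing P? p₀ zero    ¬pb = contradiction p₀ ¬pb
  crossing P? p₀ (suc b) ¬pb with P? b
  ... | yes p = b , p , ¬pb
  ... | no ¬p = crossing P? p₀ b ¬p

  -- There are 2^(p²) ≤ 2^(4u⁴) matrices of each order p < 2u², far fewer than 2^(16u⁴) ≤ d,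
  -- while log d ≤ 16(u+1)⁴.
  scale : ℕ → ℕ
  scale u = 2 * (u * u)

  exponent : ℕ → ℕ
  exponent u = 4 * (scale u * scale u)

  choose-scale : ∀ {d} → 1 ≤ d → ∃ λ u → 2 ^ exponent u ≤ d × d ≤ 2 ^ exponent (suc u)
  -- The search ends at 0, where 2 ^ `exponent 0` is 1, and may start at d because d < 2^d and d ≤
  -- `exponent d`.
  choose-scale {d} 1≤d with crossing (λ u → 2 ^ exponent u ≤? d) 1≤d d
    (<⇒≱ (<-≤-trans (n<2^n d) (^-monoʳ-≤ 2 d≤exponent)))
    where
    d≤exponent : d ≤ exponent d
    d≤exponent = begin
      d                      ≤⟨ n≤n*n d ⟩
      d * d                  ≤⟨ m≤m+n (d * d) _ ⟩
      scale d                ≤⟨ n≤n*n (scale d) ⟩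
      scale d * scale d      ≤⟨ m≤m+n (scale d * scale d) _ ⟩
      exponent d             ∎
  ... | u , low , ¬high = u , low , <⇒≤ (≰⇒> ¬high)

  -- The exact fourth root of `exponent (suc u)`, hence an upper bound for (log d)^(1/4).
  rootBound : ℕ → ℕ
  rootBound u = 2 * suc u

  exponent-suc : ∀ u → exponent (suc u) ≡ (rootBound u * rootBound u) * (rootBound u * rootBound u)
  exponent-suc = identity
    where
    identity : ∀ u → 4 * (2 * (suc u * suc u) * (2 * (suc u * suc u))) ≡ (2 * suc u * (2 * suc u)) * (2 * suc u * (2 * suc u))
    identity = solve-∀

  -- There are m orders p < m, at most 2^(m²) matrices of each order, and at most m eigenvalues of
  -- each matrix.
  smallCount : ℕ → ℕ
  smallCount m = m * (2 ^ (m * m) * m)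

  -- Spends the factor 4 in `exponent`: one m² is the number of matrices, and three more absorb the
  -- two factors m and the factor `suc u`, each bounded by a power of 2.
  smallCount-bound : ∀ u {d} → 2 ^ exponent u ≤ d → smallCount (scale u) * suc u ≤ d
  smallCount-bound u {d} low = begin
    m * (2 ^ (m * m) * m) * suc u
      ≤⟨ *-mono-≤ (*-mono-≤ (<⇒≤ (n<2^n m)) (*-monoʳ-≤ (2 ^ (m * m)) (<⇒≤ (n<2^n m)))) (n<2^n u) ⟩
    2 ^ m * (2 ^ (m * m) * 2 ^ m) * 2 ^ u
      ≡⟨ cong (λ x → 2 ^ m * x * 2 ^ u) (^-distribˡ-+-* 2 (m * m) m) ⟨
    2 ^ m * 2 ^ (m * m + m) * 2 ^ u
      ≡⟨ cong (_* 2 ^ u) (^-distribˡ-+-* 2 m (m * m + m)) ⟨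
    2 ^ (m + (m * m + m)) * 2 ^ u
      ≡⟨ ^-distribˡ-+-* 2 (m + (m * m + m)) u ⟨
    2 ^ (m + (m * m + m) + u)
      ≤⟨ ^-monoʳ-≤ 2 (begin
           m + (m * m + m) + u                 ≤⟨ +-mono-≤ (+-mono-≤ (n≤n*n m) (+-monoʳ-≤ (m * m) (n≤n*n m))) u≤m² ⟩
           m * m + (m * m + m * m) + m * m     ≡⟨ four (m * m) ⟩
           exponent u                          ∎) ⟩
    2 ^ exponent u
      ≤⟨ low ⟩
    d ∎
    where
    m = scale u
    u≤m² : u ≤ m * m
    u≤m² = ≤-trans (n≤n*n u) (≤-trans (m≤m+n (u * u) _) (n≤n*n m))
    four : ∀ x → x + (x + x) + x ≡ 4 * x
    four = solve-∀

  -- With r = u², h/d ≤ C(2r,r)/4^r ≤ 1/√(2r+1), while (u+1)² ≤ 2(2r+1). The comparison is made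
  -- between squares.
  hitCount-bound : ∀ u {d h} → h * 4 ^ (u * u) ≤ d * choose (u * u) (u * u) → h * suc u ≤ 2 * d
  hitCount-bound u {d} {h} h≤ = square-cancel-≤ (*-cancelʳ-≤ _ _ (16 ^ r) {{m^n≢0 16 r}} (begin
    (h * suc u) * (h * suc u) * 16 ^ r
      ≡⟨ cong ((h * suc u) * (h * suc u) *_) 16^r ⟩
    (h * suc u) * (h * suc u) * (4 ^ r * 4 ^ r)
      ≡⟨ regroup₁ h (suc u) (4 ^ r) ⟩
    (h * 4 ^ r) * (h * 4 ^ r) * (suc u * suc u)
      ≤⟨ *-mono-≤ (*-mono-≤ h≤ h≤) square≤ ⟩
    (d * c) * (d * c) * (2 * (2 * r + 1))
      ≡⟨ regroup₂ d c (2 * r + 1) ⟩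
    2 * (d * d) * (c * c * (2 * r + 1))
      ≤⟨ *-mono-≤ (m≤m+n (2 * (d * d)) (2 * (d * d))) (centralChoose-bound r) ⟩
    -- Doubling rounds the constant √2 up to 2.
    (2 * (d * d) + 2 * (d * d)) * 16 ^ r
      ≡⟨ cong (_* 16 ^ r) (regroup₃ d) ⟩
    (2 * d) * (2 * d) * 16 ^ r ∎))
    where
    r = u * u
    c = choose r r
    16^r : 16 ^ r ≡ 4 ^ r * 4 ^ r
    16^r = trans (^-*-assoc 4 2 r) (trans (cong (λ e → 4 ^ (r + e)) (+-identityʳ r)) (^-distribˡ-+-* 4 r r))
    square≤ : suc u * suc u ≤ 2 * (2 * r + 1)
    square≤ = begin
      suc u * suc u                  ≡⟨ expand u ⟩
      u * u + (2 * u + 1)            ≤⟨ +-monoʳ-≤ (u * u) (+-monoˡ-≤ 1 (*-monoʳ-≤ 2 (n≤n*n u))) ⟩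
      u * u + (2 * (u * u) + 1)      ≤⟨ m≤m+n _ (u * u + 1) ⟩
      u * u + (2 * (u * u) + 1) + (u * u + 1)  ≡⟨ collect (u * u) ⟩
      2 * (2 * r + 1)                ∎
      where
      expand : ∀ u → suc u * suc u ≡ u * u + (2 * u + 1)
      expand = solve-∀
      collect : ∀ x → x + (2 * x + 1) + (x + 1) ≡ 2 * (2 * x + 1)
      collect = solve-∀
    regroup₁ : ∀ h s x → (h * s) * (h * s) * (x * x) ≡ (h * x) * (h * x) * (s * s)
    regroup₁ = solve-∀
    regroup₂ : ∀ d c s → (d * c) * (d * c) * (2 * s) ≡ 2 * (d * d) * (c * c * s)
    regroup₂ = solve-∀
    regroup₃ : ∀ d → 2 * (d * d) + 2 * (d * d) ≡ (2 * d) * (2 * d)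
    regroup₃ = solve-∀

  -- Origin of the 6: small supports contribute 1 and hits 2, and `rootBound u` is twice `suc u`.
  missed-bound : ∀ u {d h k} → 2 ^ exponent u ≤ d →
    h * 4 ^ (u * u) ≤ d * choose (u * u) (u * u) → k ≤ smallCount (scale u) + h →
    k * rootBound u ≤ 6 * d
  missed-bound u {d} {h} {k} low h≤ k≤ = begin
    k * (2 * suc u)                                              ≤⟨ *-monoˡ-≤ (2 * suc u) k≤ ⟩
    (smallCount (scale u) + h) * (2 * suc u)                     ≡⟨ regroup (smallCount (scale u)) h (suc u) ⟩
    2 * (smallCount (scale u) * suc u) + 2 * (h * suc u)         ≤⟨ +-mono-≤ (*-monoʳ-≤ 2 (smallCount-bound u low))
                                                                      (*-monoʳ-≤ 2 (hitCount-bound u {d} {h} h≤)) ⟩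
    2 * d + 2 * (2 * d)                                          ≡⟨ six d ⟩
    6 * d                                                        ∎
    where
    regroup : ∀ a h s → (a + h) * (2 * s) ≡ 2 * (a * s) + 2 * (h * s)
    regroup = solve-∀
    six : ∀ d → 2 * d + 2 * (2 * d) ≡ 6 * d
    six = solve-∀

-- Counting the eigenvalues that a switching fails to make main.

module MainEigenvalues (em : ExcludedMiddle 0ℓ) where

  open import Data.Bool.Base using (Bool; true; false; if_then_else_)
  open import Data.Fin.Base using (inject≤)
  open import Data.Fin.Properties using (inject≤-injective)
  open import Data.List.Base using (List; []; _∷_; length; upTo)
  open import Data.List.Membership.Propositional using (_∈_)
  open import Data.List.Membership.Propositional.Properties using (∈-upTo⁺; ∈-upTo⁻)
  open import Data.List.Properties using (length-upTo)
  open import Data.List.Relation.Unary.Any using (here; there)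
  open import Data.Nat.Base
  open import Data.Nat.Properties
  open import Data.Nat.Tactic.RingSolver using (solve-∀)
  open import Data.Sign.Base using (Sign)
  open import Data.Vec.Base as Vec using (Vec)
  open import Data.Vec.Properties using (lookup∘tabulate)
  open import Relation.Binary.PropositionalEquality
    using (_≡_; refl; sym; trans; cong; subst)

  open ≤-Reasoning
  open RealLemmas using (≈-refl; ≈-sym; ≈-trans; ℝ-commutativeRing; noZeroDivisors; 1≉0; *-cong)
  open LinearAlgebra ℝ-commutativeRing (λ x y → em) (noZeroDivisors em) 1≉0
    using (Eigenpair; ¬1+m-eigenvalues)
  open Binomials using (choose)
  open Counting
  open LittlewoodOfford em
  open Parameters using (smallCount)

  booleans : List Bool
  booleans = true ∷ false ∷ []

  -- Vectors instead of functions, so that list membership up to `_≡_` needs no function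
  -- extensionality.
  BoolMatrix : ℕ → Set
  BoolMatrix p = Vec (Vec Bool p) p

  boolMatrices : ∀ p → List (BoolMatrix p)
  boolMatrices p = words (words booleans p) p

  ∈-boolMatrices : ∀ {p} (B : BoolMatrix p) → B ∈ boolMatrices p
  ∈-boolMatrices {p} = ∈-words (words booleans p) (∈-words booleans ∈-booleans)
    where
    ∈-booleans : ∀ b → b ∈ booleans
    ∈-booleans true  = here refl
    ∈-booleans false = there (here refl)

  length-boolMatrices : ∀ p → length (boolMatrices p) ≡ 2 ^ (p * p)
  length-boolMatrices p = trans (length-words (words booleans p) p)
    (trans (cong (_^ p) (length-words booleans p)) (^-*-assoc 2 p p))

  entry : ∀ {p} → BoolMatrix p → Matrix p
  entry B a b = if Vec.lookup (Vec.lookup B a) b then 1ℝ else 0ℝ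

  HasEigenvalue : ∀ {p} → ℝ → BoolMatrix p → Set
  HasEigenvalue μ B = ∃ (Eigenpair (entry B) μ)

  eigenvalue-count : ∀ {d p} (μ : Vector ℝ d) → (∀ {i j} → μ i ≈ℝ μ j → i ≡ j) → (B : BoolMatrix p) →
    count (λ i → em {HasEigenvalue (μ i) B}) ≤ p
  eigenvalue-count {p = p} μ μ-inj B = ≮⇒≥ λ p<count →
    ¬1+m-eigenvalues (entry B) (λ a → μ (element (inject≤ a p<count)))
      (λ eq → inject≤-injective p<count p<count _ _ (injective (μ-inj eq)))
      (λ a → sound (inject≤ a p<count))
    where open Enumeration (enumeration (λ i → em {HasEigenvalue (μ i) B}))

  module _ {n} (G : SimpleGraph n) where

    -- An eigenvector restricted to its support is an eigenvector of the induced subgraph.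
    induced-eigenvalue : ∀ {μ x} → Eigenspace G μ x → ¬ (∀ i → x i ≈ℝ 0ℝ) →
      ∃ λ (B : BoolMatrix (support x)) → HasEigenvalue μ B
    induced-eigenvalue {μ} {x} eig x≉0 = B , x ∘ element , eigen , nonzero
      where
      open Enumeration (enumeration (λ i → em {¬ x i ≈ℝ 0ℝ}))

      B : BoolMatrix (support x)
      B = Vec.tabulate λ a → Vec.tabulate λ b → adj G (element a) (element b)

      lookup-B : ∀ a b → Vec.lookup (Vec.lookup B a) b ≡ adj G (element a) (element b)
      lookup-B a b = trans
        (cong (λ row → Vec.lookup row b)
          (lookup∘tabulate (λ a → Vec.tabulate λ b → adj G (element a) (element b)) a))
        (lookup∘tabulate (λ b → adj G (element a) (element b)) b)

      entry-B : ∀ a b → entry B a b ≈ℝ adjacencyMatrix G (element a) (element b)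
      entry-B a b rewrite lookup-B a b = ≈-refl

      outside : ∀ i j → ¬ ¬ x j ≈ℝ 0ℝ → adjacencyMatrix G i j *ℝ x j ≈ℝ 0ℝ
      outside i j x≈0 = ≈-trans (*-cong ≈-refl (decidable-stable em x≈0)) (zeroʳ _)
        where open CommutativeRing ℝ-commutativeRing using (zeroʳ)

      eigen : ∀ a → ∑ (λ b → entry B a b *ℝ x (element b)) ≈ℝ μ *ℝ x (element a)
      eigen a = ≈-trans (ℝΣ.sum-cong-≋ λ b → *-cong (entry-B a b) ≈-refl)
        (≈-trans (≈-sym (∑-element (λ j → adjacencyMatrix G (element a) j *ℝ x j) (outside (element a))))
          (eig (element a)))

      nonzero : ¬ (∀ a → x (element a) ≈ℝ 0ℝ)
      nonzero x∘e≈0 = x≉0 λ i → decidable-stable em λ xi≉0 →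
        let a , eq = complete xi≉0 in xi≉0 (subst (λ j → x j ≈ℝ 0ℝ) eq (x∘e≈0 a))

    module _ {d} (f : Fin d → ∃ (Spec G)) (f-bij : Bijective _≡_ (_≈ℝ_ on proj₁) f) where

      μ : Fin d → ℝ
      μ i = proj₁ (f i)

      μ-injective : ∀ {i j} → μ i ≈ℝ μ j → i ≡ j
      μ-injective = proj₁ f-bij

      eigenvector : Fin d → Vector ℝ n
      eigenvector i = proj₁ (proj₂ (f i))

      -- Each eigenvalue with a small support is charged to its induced matrix `B`. As the `μ i` are
      -- distinct, a matrix of order p is charged at most p times.
      few-small-supports : ∀ m → count (λ i → em {support (eigenvector i) < m}) ≤ smallCount m
      few-small-supports m = begin
        ℕΣ.sum (λ i → bit (em {support (eigenvector i) < m}))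
          ≤⟨ ∑-mono covered ⟩
        ℕΣ.sum (λ i → ∑ₗ (upTo m) λ p → ∑ₗ (boolMatrices p) λ B → bit (em {HasEigenvalue (μ i) B}))
          ≡⟨ ∑ₗ-∑ (upTo m) (λ p i → ∑ₗ (boolMatrices p) λ B → bit (em {HasEigenvalue (μ i) B})) ⟨
        ∑ₗ (upTo m) (λ p → ℕΣ.sum (λ i → ∑ₗ (boolMatrices p) λ B → bit (em {HasEigenvalue (μ i) B})))
          ≤⟨ ∑ₗ-upper (upTo m) (λ p∈ → of-order (∈-upTo⁻ p∈)) ⟩
        length (upTo m) * (2 ^ (m * m) * m)
          ≡⟨ cong (_* (2 ^ (m * m) * m)) (length-upTo m) ⟩
        smallCount m ∎
        where
        covered : ∀ i → bit (em {support (eigenvector i) < m}) ≤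
          ∑ₗ (upTo m) (λ p → ∑ₗ (boolMatrices p) λ B → bit (em {HasEigenvalue (μ i) B}))
        covered i with em {support (eigenvector i) < m}
        ... | no  _      = z≤n
        ... | yes supp<m = let B , eig = induced-eigenvalue (proj₁ (proj₂ (proj₂ (f i)))) (proj₂ (proj₂ (proj₂ (f i)))) in begin
          1
            ≡⟨ bit-true em eig ⟨
          bit (em {HasEigenvalue (μ i) B})
            ≤⟨ ∈⇒≤∑ₗ (λ B → bit (em {HasEigenvalue (μ i) B})) (∈-boolMatrices B) ⟩
          ∑ₗ (boolMatrices (support (eigenvector i))) (λ B → bit (em {HasEigenvalue (μ i) B}))
            ≤⟨ ∈⇒≤∑ₗ (λ p → ∑ₗ (boolMatrices p) λ B → bit (em {HasEigenvalue (μ i) B})) (∈-upTo⁺ supp<m) ⟩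
          ∑ₗ (upTo m) (λ p → ∑ₗ (boolMatrices p) λ B → bit (em {HasEigenvalue (μ i) B})) ∎

        of-order : ∀ {p} → p < m →
          ℕΣ.sum (λ i → ∑ₗ (boolMatrices p) λ B → bit (em {HasEigenvalue (μ i) B})) ≤ 2 ^ (m * m) * m
        of-order {p} p<m = begin
          ℕΣ.sum (λ i → ∑ₗ (boolMatrices p) λ B → bit (em {HasEigenvalue (μ i) B}))
            ≡⟨ ∑ₗ-∑ (boolMatrices p) (λ B i → bit (em {HasEigenvalue (μ i) B})) ⟨
          ∑ₗ (boolMatrices p) (λ B → count (λ i → em {HasEigenvalue (μ i) B}))
            ≤⟨ ∑ₗ-upper (boolMatrices p) (λ {B} _ → eigenvalue-count μ μ-injective B) ⟩
          length (boolMatrices p) * p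
            ≡⟨ cong (_* p) (length-boolMatrices p) ⟩
          2 ^ (p * p) * p
            ≤⟨ *-mono-≤ (^-monoʳ-≤ 2 (*-mono-≤ (<⇒≤ p<m) (<⇒≤ p<m))) (<⇒≤ p<m) ⟩
          2 ^ (m * m) * m ∎

      Main : Switching n → Fin d → Set
      Main s i = Eigenspace G (μ i) ⊈ s ^⊥

      mainSpec-count : ∀ s → ∣ MainSpec G s ∣≡ count (λ i → em {Main s i})
      mainSpec-count s = g , g-injective , g-surjective
        where
        open Enumeration (enumeration (λ i → em {Main s i}))

        g : Fin (count (λ i → em {Main s i})) → ∃ (MainSpec G s)
        g a = μ (element a) , proj₂ (f (element a)) , sound a

        g-injective : ∀ {a b} → μ (element a) ≈ℝ μ (element b) → a ≡ b
        g-injective eq = injective (μ-injective eq)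

        g-surjective : ∀ (y : ∃ (MainSpec G s)) → ∃ λ a → ∀ {b} → b ≡ a → μ (element b) ≈ℝ proj₁ y
        g-surjective (ν , ν∈spec , main) =
          let i , at-i = proj₂ f-bij (ν , ν∈spec)
              μi≈ν = at-i refl
              -- `ν` and `μ i` agree only up to `_≈ℝ_`, so membership in the eigenspace has to be
              -- carried from one to the other.
              a , eq = complete {i} λ E⊆ → main λ x∈E → E⊆ λ j →
                ≈-trans (x∈E j) (*-cong (≈-sym μi≈ν) ≈-refl)
          in a , λ where refl → subst (λ j → μ j ≈ℝ ν) (sym eq) μi≈ν

      -- Containing the support condition, the event is impossible for small supports, so the bound
      -- on its frequency holds uniformly in i.
      Hit : ℕ → Vec Sign n → Fin d → Set
      Hit r s i = 2 * r ≤ support (eigenvector i) × dot s (eigenvector i) ≈ℝ 0ℝ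

      missed≤ : ∀ r s → count (λ i → em {¬ Main (Vec.lookup s) i}) ≤
                smallCount (2 * r) + count (λ i → em {Hit r s i})
      missed≤ r s = begin
        count (λ i → em {¬ Main (Vec.lookup s) i})
          ≤⟨ ∑-mono (λ i → bit-⊎ (em {¬ Main (Vec.lookup s) i}) (em {support (eigenvector i) < 2 * r}) (em {Hit r s i}) (cases i)) ⟩
        ℕΣ.sum (λ i → bit (em {support (eigenvector i) < 2 * r}) + bit (em {Hit r s i}))
          ≡⟨ ℕΣ.∑-distrib-+ (λ i → bit (em {support (eigenvector i) < 2 * r})) (λ i → bit (em {Hit r s i})) ⟩
        count (λ i → em {support (eigenvector i) < 2 * r}) + count (λ i → em {Hit r s i})
          ≤⟨ +-monoˡ-≤ (count (λ i → em {Hit r s i})) (few-small-supports (2 * r)) ⟩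
        smallCount (2 * r) + count (λ i → em {Hit r s i}) ∎
        where
        cases : ∀ i → ¬ Main (Vec.lookup s) i → support (eigenvector i) < 2 * r ⊎ Hit r s i
        cases i ¬main with support (eigenvector i) <? 2 * r
        ... | yes small = inj₁ small
        -- An eigenvalue that is not main has its whole eigenspace orthogonal to s, in particular
        -- the chosen eigenvector.
        ... | no  large = inj₂ (≮⇒≥ large , decidable-stable em λ s·x≉0 →
          ¬main λ E⊆ → s·x≉0 (E⊆ (proj₁ (proj₂ (proj₂ (f i))))))

      few-hits : ∀ r i → ∑ₗ (words signs n) (λ s → bit (em {Hit r s i})) * 4 ^ r ≤ 2 ^ n * choose r r
      few-hits r i with 2 * r ≤? support (eigenvector i)
      ... | yes large = ≤-trans
        (*-monoˡ-≤ (4 ^ r) (∑ₗ-mono (words signs n) λ s → bit-mono (em {Hit r s i}) em proj₂))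
        (hits-0 (eigenvector i) r large)
      ... | no  small = ≤-trans
        (*-monoˡ-≤ (4 ^ r) (∑ₗ-upper (words signs n) {c = 0} λ {s} _ →
          ≤-reflexive (bit-false (em {Hit r s i}) λ hit → small (proj₁ hit))))
        (≤-trans (≤-reflexive (cong (_* 4 ^ r) (*-zeroʳ (length (words signs n))))) z≤n)

      -- First moment method: the hits are summed over all switchings, the sums are exchanged, and
      -- some switching is no worse than the average.
      good-switching : ∀ r → ∃ λ s → count (λ i → em {Hit r s i}) * 4 ^ r ≤ d * choose r r
      good-switching r = let s , lt = below-average (words signs n) average in s , s≤s⁻¹ lt
        where
        H : Vec Sign n → Fin d → ℕ
        H s i = bit (em {Hit r s i})

        ∑ₗ-* : ∀ (xs : List (Vec Sign n)) (g : Vec Sign n → ℕ) c → ∑ₗ xs (λ s → g s * c) ≡ ∑ₗ xs g * c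
        ∑ₗ-* []       g c = refl
        ∑ₗ-* (x ∷ xs) g c = trans (cong (g x * c +_) (∑ₗ-* xs g c)) (sym (*-distribʳ-+ c (g x) (∑ₗ xs g)))

        swap : ∀ d a b → d * (a * b) ≡ a * (d * b)
        swap = solve-∀

        -- The threshold is one above the mean bound because `below-average` needs a strict
        -- inequality; `s≤s⁻¹` takes the one off again.
        average : ∑ₗ (words signs n) (λ s → ℕΣ.sum (H s) * 4 ^ r) < length (words signs n) * suc (d * choose r r)
        average = begin-strict
          ∑ₗ (words signs n) (λ s → ℕΣ.sum (H s) * 4 ^ r)
            ≡⟨ ∑ₗ-* (words signs n) (λ s → ℕΣ.sum (H s)) (4 ^ r) ⟩
          ∑ₗ (words signs n) (λ s → ℕΣ.sum (H s)) * 4 ^ r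
            ≡⟨ cong (_* 4 ^ r) (∑ₗ-∑ (words signs n) H) ⟩
          ℕΣ.sum (λ i → ∑ₗ (words signs n) (λ s → H s i)) * 4 ^ r
            ≡⟨ ℕΣ.*-distribʳ-sum (4 ^ r) (λ i → ∑ₗ (words signs n) (λ s → H s i)) ⟩
          ℕΣ.sum (λ i → ∑ₗ (words signs n) (λ s → H s i) * 4 ^ r)
            ≤⟨ ∑-upper (few-hits r) ⟩
          d * (2 ^ n * choose r r)
            ≡⟨ swap d (2 ^ n) (choose r r) ⟩
          2 ^ n * (d * choose r r)
            <⟨ *-monoʳ-< (2 ^ n) {{m^n≢0 2 n}} (n<1+n (d * choose r r)) ⟩
          2 ^ n * suc (d * choose r r)
            ≡⟨ cong (_* suc (d * choose r r)) (length-words signs n) ⟨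
          length (words signs n) * suc (d * choose r r) ∎

-- Assembly of the estimates with C = 6.

open import Data.Nat using (ℕ; _≤_)

theorem1p5 : ExcludedMiddle 0ℓ →
    ∃[ C ] 0ℝ <ℝ C ×
    (∀ (n : ℕ) → 5 ≤ n → (G : SimpleGraph n) →
    ∀ (d : ℕ) → (2≤d : 2 ≤ d) → ∣ Spec G ∣≡ d →
    ∃[ s ] ∃[ M ] ∣ MainSpec G s ∣≡ M ×
    fromℕ d -ℝ C *ℝ (fromℕ d ÷ℝ (log d) ^¼ [ 0<^¼ (log d) (0<log 2≤d) ]) ≤ℝ fromℕ M)
theorem1p5 em = fromℕ 6 , 0<6 , λ n _ G d 2≤d (f , f-bij) →
  let u , low , high = choose-scale (≤-trans (s≤s z≤n) 2≤d)
      -- With r = u², the support threshold 2r is `scale u` by definition, so the bounds on both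
      -- kinds of missed eigenvalues fit together.
      s , hits≤ = good-switching G f f-bij (u * u)
      main? = λ i → em {Main G f f-bij (Vec.lookup s) i}
      missed? = λ i → em {¬ Main G f f-bij (Vec.lookup s) i}
  in Vec.lookup s , count main? , mainSpec-count G f f-bij (Vec.lookup s) ,
     log-estimate {M = count main?} {k = count missed?} (rootBound u) 6 2≤d (count-¬ main? missed?) (s≤s z≤n)
       (≤-trans high (≤-reflexive (cong (2 ^_) (exponent-suc u))))
       (missed-bound u {h = count (λ i → em {Hit G f f-bij (u * u) s i})} {k = count missed?} low hits≤ (missed≤ G f f-bij (u * u) s))
  where
  open import Data.Nat.Base using (s≤s; z≤n; _^_; _*_)
  open import Data.Nat.Properties using (≤-trans; ≤-reflexive)
  open import Data.Rational.Base using (1ℚ)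
  open import Data.Vec.Base as Vec using ()
  open import Relation.Binary.PropositionalEquality using (cong)
  open MainEigenvalues em
  open Counting
  open Parameters
  open LogarithmBound

  0<6 : 0ℝ <ℝ fromℕ 6
  0<6 = mk< 1ℚ ℚ-Lemmas.0<1 0 λ _ _ → ℚ-Lemmas.ι-mono-≤ {1} {6} (s≤s z≤n)
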